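{- Let $p\in(0,1)$ and $p_{ - }=\min\{p,1/2\}$. For the probabilistic triad dynamics with parameter $p$ on the triadic cycle $TC_{n}$, the time to social balance $\tau_{SB}(TC_n)$ is $O(n/p_{ - })$.
   Context: Edges are labeled $\pm1$; a triangle is balanced if the product of its edge labels is $1$. Probabilistic triad dynamics with parameter $p$: while an imbalanced triangle exists, choose an imbalanced triangle $T$ uniformly at random; if $T$ has a single negative edge $e$, then with probability $p$ turn $e$ positive and with probability $1-p$ turn one of the other two edges of $T$ (chosen at random) negative; otherwise ($T$ has three negative edges) change the label of a uniformly random edge of $T$. The triadic cycle $TC_n$ is the graph consisting of $n$ triangles chained together, consecutive triangles sharing an edge, with the two free edges $AB$ and $CD$ of the extreme triangles of the chain glued by identifying $A\equiv C$, $B\equiv D$; thus each triangle shares one edge with each of its two neighbours and has one edge belonging to no other triangle. For such a graph, $\tau_{SB}(G)$ is the maximum over all initial labelings $s$ of the expected number of steps for the dynamics started at $s$ to reach a state with no imbalanced triangle. -}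

module Defs where

open import Algebra.Bundles using (CommutativeRing)
import Algebra.Definitions.RawMonoid as RawMonoidDefinitions
open import Data.Fin.Base as Fin using (Fin; inject₁)
import Data.Fin.Properties as Fin
open import Data.List.Base using (List; []; _∷_; _++_; allFin; cartesianProduct; filter)
import Data.List.Base as List
open import Data.List.NonEmpty.Base as List⁺ using (List⁺; _∷_)
open import Data.Nat.Base as ℕ using (ℕ; zero; suc)
open import Data.Product.Base using (∃-syntax; _×_; _,_; proj₁; proj₂)
open import Data.Sign.Base as Sign using (Sign)
import Data.Sign.Properties as Sign
open import Data.Sum.Base using (_⊎_; inj₁; inj₂)
open import Data.Vec.Base using (Vec; lookup; updateAt)
open import Function.Definitions using (Injective)
open import Level using (Level; _⊔_) renaming (suc to lsuc)
open import Relation.Binary.Core using (Rel)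
open import Relation.Binary.Definitions using (Cotransitive; Antisymmetric)
open import Relation.Binary.Lattice.Definitions using (Infimum)
open import Relation.Binary.PropositionalEquality.Core using (_≡_)
import Relation.Binary.Reasoning.Setoid as SetoidReasoning
open import Relation.Binary.Structures using (IsStrictPartialOrder)
open import Relation.Nullary.Decidable.Core using (yes; no; _×-dec_; ¬?)
open import Relation.Nullary.Negation.Core using (¬_; contradiction)
open import Relation.Unary using (Pred; Decidable)

------------------------------------------------------------------------
-- The real numbers, axiomatised as an Archimedean, Cauchy-complete
-- ordered field.  Classically this determines ℝ up to isomorphism; the
-- axioms are phrased (cotransitive strict order, inverses of positive
-- elements, binary minima) so that Bishop's reals satisfy them as well.

record RealNumbers (c ℓ₁ ℓ₂ : Level) : Set (lsuc (c ⊔ ℓ₁ ⊔ ℓ₂)) where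
  infix  4 _<_ _≤_
  infixl 7 _⊓_

  field
    commutativeRing : CommutativeRing c ℓ₁

  open CommutativeRing commutativeRing public
  open RawMonoidDefinitions +-rawMonoid using () renaming (_×_ to _×1#_)

  field
    _<_ : Rel Carrier ℓ₂

  _≤_ : Rel Carrier ℓ₂
  x ≤ y = ¬ (y < x)

  Positive : Pred Carrier ℓ₂
  Positive x = 0# < x

  fromℕ : ℕ → Carrier
  fromℕ n = n ×1# 1#

  Cauchy : (ℕ → Carrier) → Set (c ⊔ ℓ₂)
  Cauchy f = ∀ ε → Positive ε →
    ∃[ N ] ∀ m n → N ℕ.≤ m → N ℕ.≤ n → f m < f n + ε

  ConvergesTo : (ℕ → Carrier) → Carrier → Set (c ⊔ ℓ₂)
  ConvergesTo f x = ∀ ε → Positive ε →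
    ∃[ N ] ∀ n → N ℕ.≤ n → x - ε < f n × f n < x + ε

  field
    isStrictPartialOrder : IsStrictPartialOrder _≈_ _<_
    <-cotrans      : Cotransitive _<_
    ≤-antisym      : Antisymmetric _≈_ _≤_
    0<1            : 0# < 1#
    +-monoʳ-<      : ∀ x {y z} → y < z → x + y < x + z
    *-positive     : ∀ {x y} → Positive x → Positive y → Positive (x * y)
    recip          : ∀ x → Positive x → Carrier
    *-recip        : ∀ x (x>0 : Positive x) → x * recip x x>0 ≈ 1#
    recip-positive : ∀ x (x>0 : Positive x) → Positive (recip x x>0)
    _⊓_            : Carrier → Carrier → Carrier
    ⊓-infimum      : Infimum _≤_ _⊓_
    archimedean    : ∀ x → ∃[ n ] x < fromℕ n
    complete       : ∀ f → Cauchy f → ∃[ x ] ConvergesTo f x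

  open IsStrictPartialOrder isStrictPartialOrder public
    using (<-respʳ-≈; <-respˡ-≈)
    renaming (trans to <-trans; irrefl to <-irrefl; asym to <-asym)

  <-≤-trans : ∀ {x y z} → x < y → y ≤ z → x < z
  <-≤-trans {z = z} x<y y≤z with <-cotrans x<y z
  ... | inj₁ x<z = x<z
  ... | inj₂ z<y = contradiction z<y y≤z

  x<1+x : ∀ x → x < 1# + x
  x<1+x x = <-respˡ-≈ (+-identityʳ x) (<-respʳ-≈ (+-comm x 1#) (+-monoʳ-< x 0<1))

  fromℕ-positive : ∀ n → Positive (fromℕ (suc n))
  fromℕ-positive zero    = x<1+x 0#
  fromℕ-positive (suc n) = <-trans (fromℕ-positive n) (x<1+x _)

  *-monoˡ-< : ∀ {x y z} → Positive z → x < y → x * z < y * z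
  *-monoˡ-< {x} {y} {z} z>0 x<y =
    <-respˡ-≈ (+-identityʳ _) (<-respʳ-≈ eq (+-monoʳ-< (x * z) (*-positive y-x>0 z>0)))
    where
    open SetoidReasoning setoid
    y-x>0 : Positive (- x + y)
    y-x>0 = <-respˡ-≈ (-‿inverseˡ x) (+-monoʳ-< (- x) x<y)
    eq : x * z + (- x + y) * z ≈ y * z
    eq = begin
      x * z + (- x + y) * z  ≈⟨ distribʳ z x (- x + y) ⟨
      (x + (- x + y)) * z    ≈⟨ *-congʳ (+-assoc x (- x) y) ⟨
      (x + - x + y) * z      ≈⟨ *-congʳ (+-congʳ (-‿inverseʳ x)) ⟩
      (0# + y) * z           ≈⟨ *-congʳ (+-identityˡ y) ⟩
      y * z                  ∎

  1/1+_ : ℕ → Carrier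
  1/1+ n = recip (fromℕ (suc n)) (fromℕ-positive n)

  ½ : Carrier
  ½ = 1/1+ 1

  ½-positive : Positive ½
  ½-positive = recip-positive _ _

  ½<1 : ½ < 1#
  ½<1 = <-respˡ-≈ (*-identityˡ ½) (<-respʳ-≈ (*-recip _ _)
    (*-monoˡ-< ½-positive (<-respˡ-≈ (+-identityʳ 1#) (x<1+x _))))

  ⊓-½-positive : ∀ {p} → 0# < p → p < 1# → Positive (p ⊓ ½)
  ⊓-½-positive {p} p>0 p<1 = <-≤-trans (*-positive p>0 ½-positive)
    (proj₂ (proj₂ (⊓-infimum p ½)) (p * ½) (<-asym p½<p) (<-asym p½<½))
    where
    p½<p : p * ½ < p
    p½<p = <-respˡ-≈ (*-comm ½ p) (<-respʳ-≈ (*-identityˡ p) (*-monoˡ-< p>0 ½<1))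
    p½<½ : p * ½ < ½
    p½<½ = <-respʳ-≈ (*-identityˡ ½) (*-monoˡ-< ½-positive p<1)

  Σ[_]_ : ℕ → (ℕ → Carrier) → Carrier
  Σ[ zero  ] f = 0#
  Σ[ suc n ] f = Σ[ n ] f + f n

  SumsTo : (ℕ → Carrier) → Carrier → Set (c ⊔ ℓ₂)
  SumsTo f = ConvergesTo (Σ[_] f)

------------------------------------------------------------------------
-- Finite simple graphs: each edge is stored once, with its two
-- endpoints listed in increasing order.

record Graph : Set where
  field
    #vertices #edges : ℕ

  Vertex : Set
  Vertex = Fin #vertices

  Edge : Set
  Edge = Fin #edges

  field
    source target : Edge → Vertex
    source<target : ∀ e → source e Fin.< target e
    simple        : ∀ {e f} → source e ≡ source f → target e ≡ target f → e ≡ f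

  Triple : Set
  Triple = Edge × Edge × Edge

  -- The edges uv, vw, uw of a 3-clique with vertices u < v < w.  Thus
  -- every triangle of the graph corresponds to exactly one triple.
  IsTriangle : Pred Triple _
  IsTriangle (uv , vw , uw) =
    source uv ≡ source uw × target uv ≡ source vw × target vw ≡ target uw

  isTriangle? : Decidable IsTriangle
  isTriangle? (uv , vw , uw) =
    source uv Fin.≟ source uw ×-dec
    target uv Fin.≟ source vw ×-dec
    target vw Fin.≟ target uw

  triangles : List Triple
  triangles = filter isTriangle?
    (cartesianProduct (allFin #edges) (cartesianProduct (allFin #edges) (allFin #edges)))

  infix 4 _∈ₑ_
  _∈ₑ_ : Edge → Triple → Set
  e ∈ₑ (a , b , c) = e ≡ a ⊎ e ≡ b ⊎ e ≡ c

-- G is a triadic cycle TC n: a chain of n triangles in which triangle i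
-- is entered through the edge shared i and left through the edge
-- shared (i + 1), closed up by identifying the free edge shared 0 of the
-- first triangle with the free edge shared n of the last one.  The shape
-- of the chain (which endpoint of shared i is kept in shared (i + 1)) is
-- left arbitrary.

record IsTriadicCycle (n : ℕ) (G : Graph) : Set where
  open Graph G
  field
    n≥3                : 3 ℕ.≤ n
    triangle           : Fin n → Triple
    triangle-valid     : ∀ i → IsTriangle (triangle i)
    triangle-injective : Injective _≡_ _≡_ triangle
    triangle-all       : ∀ T → IsTriangle T → ∃[ i ] triangle i ≡ T
    edge-covered       : ∀ e → ∃[ i ] e ∈ₑ triangle i

    shared             : Fin (suc n) → Edge
    shared-in          : ∀ i → shared (inject₁ i) ∈ₑ triangle i
    shared-out         : ∀ i → shared (Fin.suc i) ∈ₑ triangle i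
    glued              : shared Fin.zero ≡ shared (Fin.fromℕ n)
    shared-injective   : ∀ {i j} → shared (inject₁ i) ≡ shared (inject₁ j) → i ≡ j

    private-edge       : Fin n → Edge
    private-edge-in    : ∀ i → private-edge i ∈ₑ triangle i
    private-edge-only  : ∀ i j → private-edge i ∈ₑ triangle j → i ≡ j

------------------------------------------------------------------------
-- Probabilistic triad dynamics with parameter p on the graph G

module TriadDynamics
  {c ℓ₁ ℓ₂} (ℝ : RealNumbers c ℓ₁ ℓ₂) (p : RealNumbers.Carrier ℝ) (G : Graph)
  where

  open RealNumbers ℝ
  open Graph G

  -- Finitely supported distributions, as lists of weighted outcomes.
  Dist : Set → Set c
  Dist A = List (Carrier × A)

  private variable
    A B : Set

  scale : Carrier → Dist A → Dist A
  scale q = List.map λ (w , a) → (q * w , a)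

  pure : A → Dist A
  pure a = (1# , a) ∷ []

  infixl 1 _>>=_
  _>>=_ : Dist A → (A → Dist B) → Dist B
  []            >>= k = []
  ((w , a) ∷ μ) >>= k = scale w (k a) ++ (μ >>= k)

  uniform : List⁺ A → Dist A
  uniform (x ∷ xs) = List.map (1/1+ List.length xs ,_) (x ∷ xs)

  bernoulli : Carrier → Dist A → Dist A → Dist A
  bernoulli q μ ν = scale q μ ++ scale (1# - q) ν

  𝔼 : Dist A → (A → Carrier) → Carrier
  𝔼 []            f = 0#
  𝔼 ((w , a) ∷ μ) f = w * f a + 𝔼 μ f

  Labeling : Set
  Labeling = Vec Sign #edges

  flip : Edge → Labeling → Labeling
  flip e s = updateAt s e Sign.opposite

  Balanced : Labeling → Pred Triple _
  Balanced s (a , b , c) = lookup s a Sign.* lookup s b Sign.* lookup s c ≡ Sign.+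

  balanced? : ∀ s → Decidable (Balanced s)
  balanced? s (a , b , c) = lookup s a Sign.* lookup s b Sign.* lookup s c Sign.≟ Sign.+

  imbalancedTriangles : Labeling → List Triple
  imbalancedTriangles s = filter (λ T → ¬? (balanced? s T)) triangles

  -- The edge to flip in an imbalanced triangle, given the labels of its
  -- edges.  In the last clause the triangle is all negative, as the
  -- remaining sign patterns are balanced.
  chooseEdge : Sign × Sign × Sign → Triple → Dist Edge
  chooseEdge (Sign.- , Sign.+ , Sign.+) (a , b , c) = bernoulli p (pure a) (uniform (b ∷ c ∷ []))
  chooseEdge (Sign.+ , Sign.- , Sign.+) (a , b , c) = bernoulli p (pure b) (uniform (a ∷ c ∷ []))
  chooseEdge (Sign.+ , Sign.+ , Sign.-) (a , b , c) = bernoulli p (pure c) (uniform (a ∷ b ∷ []))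
  chooseEdge _                          (a , b , c) = uniform (a ∷ b ∷ c ∷ [])

  labels : Labeling → Triple → Sign × Sign × Sign
  labels s (a , b , c) = lookup s a , lookup s b , lookup s c

  stepFrom : Labeling → List Triple → Dist Labeling
  stepFrom s []       = pure s
  stepFrom s (T ∷ Ts) =
    uniform (T ∷ Ts) >>= λ T′ →
    chooseEdge (labels s T′) T′ >>= λ e →
    pure (flip e s)

  step : Labeling → Dist Labeling
  step s = stepFrom s (imbalancedTriangles s)

  -- hitsAt t s is the probability that, started at s, the dynamics first
  -- has no imbalanced triangle after exactly t steps.
  hitsAt : ℕ → Labeling → Carrier
  hitsAt zero s with imbalancedTriangles s
  ... | []    = 1#
  ... | _ ∷ _ = 0#
  hitsAt (suc t) s with imbalancedTriangles s
  ... | []    = 0#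
  ... | _ ∷ _ = 𝔼 (step s) (hitsAt t)

  -- A balanced state is reached almost surely, in e steps on average.
  HasExpectedTime : Labeling → Carrier → Set (c ⊔ ℓ₂)
  HasExpectedTime s e =
    SumsTo (λ t → hitsAt t s) 1# × SumsTo (λ t → fromℕ t * hitsAt t s) e

  -- τ is the maximum over all initial labelings of the expected time to
  -- reach balance, as the least upper bound of this finite family.
  record IsBalanceTime (τ : Carrier) : Set (c ⊔ ℓ₂) where
    field
      expectedTime : Labeling → Carrier
      isExpected   : ∀ s → HasExpectedTime s (expectedTime s)
      upperBound   : ∀ s → expectedTime s ≤ τ
      least        : ∀ b → (∀ s → expectedTime s ≤ b) → τ ≤ b

{-# OPTIONS --safe #-}
module Submission where

-- Let q = min(p, 1/2), let X be the number of imbalanced triangles and N the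
-- number of negative edges, and put Φ = (2/q) X + N.  Every edge lies in at
-- most two triangles, so flipping an edge of an imbalanced triangle never
-- increases X, and flipping its private edge decreases X by one.  Hence, as
-- long as some triangle is imbalanced, one step decreases Φ by at least 1 on
-- average: the three-negative case already decreases N; when the only negative
-- edge is the private one, X drops with probability p ≥ q; and when it is a
-- shared one, either N drops, or (with probability 1 - p) X drops half of the
-- time, which the factor 2/q ≥ 4 makes outweigh the possible increase of N.
-- So the expected time is at most the initial value of Φ, which is O(n / q).
-- Neither p ≤ 1/2 nor p ≥ 1/2 has to be decided.

open import Defs
import Algebra.Properties.CommutativeMonoid.Sum as Sum
import Algebra.Properties.Monoid.Mult as MonoidMult
import Algebra.Properties.Ring as RingProperties
import Algebra.Properties.Semiring.Mult as SemiringMult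
import Algebra.Solver.Ring.NaturalCoefficients.Default as SemiringSolver
open import Data.Bool.Base using (if_then_else_)
open import Data.Fin.Base as Fin using (Fin; zero; suc; inject₁; combine)
open import Data.Fin.Patterns using (0F; 1F; 2F)
import Data.Fin.Properties as Fin
open import Data.Fin.Relation.Unary.Top using (view; ‵fromℕ; ‵inject₁)
open import Data.List.Base as List using (List; []; _∷_; _++_; length; allFin; cartesianProduct)
open import Data.List.NonEmpty.Base using (List⁺; _∷_)
open import Data.List.Relation.Unary.All as All using (All; []; _∷_)
import Data.List.Relation.Unary.All.Properties as All
open import Data.Nat.Base as ℕ using (ℕ; zero; suc)
import Data.Nat.Properties as ℕ
open import Data.Product.Base using (∃-syntax; _×_; _,_; proj₁; proj₂)
open import Data.Sign.Base as Sign using (Sign; opposite)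
import Data.Sign.Properties as Sign
open import Data.Sum.Base as ⊎ using (_⊎_; inj₁; inj₂; [_,_]′)
open import Data.Vec.Base using (Vec; []; _∷_; lookup)
open import Data.Vec.Properties using (lookup∘updateAt; lookup∘updateAt′)
open import Function.Base using (_∘_; const)
open import Function.Definitions using (Injective)
import Level
open import Relation.Binary.PropositionalEquality.Core as ≡ using (_≡_; _≢_)
import Relation.Binary.Reasoning.Base.Triple as TripleReasoning
open import Relation.Binary.Structures using (IsPreorder)
open import Relation.Nullary.Decidable.Core using (yes; no; does; ¬?)
open import Relation.Nullary.Negation.Core using (¬_; contradiction)

-- Order, finite sums and limits over the constructive real numbers.

module RealProperties {c ℓ₁ ℓ₂} (ℝ : RealNumbers c ℓ₁ ℓ₂) where

  open RealNumbers ℝ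
  open MonoidMult +-monoid using (×-homo-+)
  open SemiringMult semiring using (×1-homo-*)
  open RingProperties ring using (-‿involutive)
  open SemiringSolver commutativeSemiring public using (solve; con; _:=_; _:+_; _:*_)

  private variable
    x y z u v ε : Carrier

  ≤-reflexive : x ≈ y → x ≤ y
  ≤-reflexive x≈y = <-irrefl (sym x≈y)

  ≤-refl : x ≤ x
  ≤-refl = ≤-reflexive refl

  -- As `_≤_` is the negation of the reversed strict order, cotransitivity does the work: it
  -- compares the middle point with the two ends of `z < x`.
  ≤-trans : x ≤ y → y ≤ z → x ≤ z
  ≤-trans {y = y} x≤y y≤z z<x = [ y≤z , x≤y ]′ (<-cotrans z<x y)

  ≤-<-trans : x ≤ y → y < z → x < z
  ≤-<-trans {x = x} x≤y y<z with <-cotrans y<z x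
  ... | inj₁ y<x = contradiction y<x x≤y
  ... | inj₂ x<z = x<z

  ≤-isPreorder : IsPreorder _≈_ _≤_
  ≤-isPreorder = record { isEquivalence = isEquivalence ; reflexive = ≤-reflexive ; trans = ≤-trans }

  module ≤-Reasoning = TripleReasoning ≤-isPreorder
    <-asym <-trans (<-respʳ-≈ , <-respˡ-≈) <-asym <-≤-trans ≤-<-trans
    hiding (step-≈; step-≈˘)

  open ≤-Reasoning

  +-cancelˡ-< : ∀ x → x + y < x + z → y < z
  +-cancelˡ-< {y} {z} x x+y<x+z = begin-strict
    y              ≈⟨ cancel y ⟨
    - x + (x + y)  <⟨ +-monoʳ-< (- x) x+y<x+z ⟩
    - x + (x + z)  ≈⟨ cancel z ⟩
    z              ∎
    where
    cancel : ∀ w → - x + (x + w) ≈ w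
    cancel w = trans (sym (+-assoc _ _ _)) (trans (+-congʳ (-‿inverseˡ x)) (+-identityˡ w))

  +-monoʳ-≤ : ∀ x → y ≤ z → x + y ≤ x + z
  +-monoʳ-≤ x y≤z = y≤z ∘ +-cancelˡ-< x

  +-monoˡ-≤ : ∀ x → y ≤ z → y + x ≤ z + x
  +-monoˡ-≤ {y} {z} x y≤z = begin
    y + x  ≈⟨ +-comm y x ⟩
    x + y  ≤⟨ +-monoʳ-≤ x y≤z ⟩
    x + z  ≈⟨ +-comm x z ⟩
    z + x  ∎

  +-mono-≤ : x ≤ y → u ≤ v → x + u ≤ y + v
  +-mono-≤ x≤y u≤v = ≤-trans (+-monoˡ-≤ _ x≤y) (+-monoʳ-≤ _ u≤v)

  +-cancelˡ-≤ : ∀ x → x + y ≤ x + z → y ≤ z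
  +-cancelˡ-≤ x x+y≤x+z z<y = x+y≤x+z (+-monoʳ-< x z<y)

  +-cancelʳ-≤ : ∀ x → y + x ≤ z + x → y ≤ z
  +-cancelʳ-≤ {y} {z} x le = +-cancelˡ-≤ x (begin
    x + y  ≈⟨ +-comm x y ⟩
    y + x  ≤⟨ le ⟩
    z + x  ≈⟨ +-comm z x ⟩
    x + z  ∎)

  x≤x+y : 0# ≤ y → x ≤ x + y
  x≤x+y {y} {x} 0≤y = begin
    x       ≈⟨ +-identityʳ x ⟨
    x + 0#  ≤⟨ +-monoʳ-≤ x 0≤y ⟩
    x + y   ∎

  x≤y+x : 0# ≤ y → x ≤ y + x
  x≤y+x {y} {x} 0≤y = ≤-trans (x≤x+y 0≤y) (≤-reflexive (+-comm x y))

  +-nonNegative : 0# ≤ x → 0# ≤ y → 0# ≤ x + y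
  +-nonNegative 0≤x 0≤y = ≤-trans 0≤x (x≤x+y 0≤y)

  neg-antimono-≤ : x ≤ y → - y ≤ - x
  neg-antimono-≤ {x} {y} x≤y = +-cancelˡ-≤ x (begin
    x + - y  ≤⟨ +-monoˡ-≤ (- y) x≤y ⟩
    y + - y  ≈⟨ -‿inverseʳ y ⟩
    0#       ≈⟨ -‿inverseʳ x ⟨
    x + - x  ∎)

  *-cancelʳ-< : 0# < z → x * z < y * z → x < y
  *-cancelʳ-< {z} {x} {y} z>0 xz<yz = begin-strict
    x                       ≈⟨ cancel x ⟨
    x * z * recip z z>0     <⟨ *-monoˡ-< (recip-positive z z>0) xz<yz ⟩
    y * z * recip z z>0     ≈⟨ cancel y ⟩
    y                       ∎
    where
    cancel : ∀ w → w * z * recip z z>0 ≈ w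
    cancel w = trans (*-assoc _ _ _) (trans (*-congˡ (*-recip z z>0)) (*-identityʳ w))

  *-cancelʳ-≤ : 0# < z → x * z ≤ y * z → x ≤ y
  *-cancelʳ-≤ z>0 xz≤yz y<x = xz≤yz (*-monoˡ-< z>0 y<x)

  -- If yz < xz then z is not positive, hence zero by antisymmetry.
  *-monoʳ-≤ : 0# ≤ z → x ≤ y → x * z ≤ y * z
  *-monoʳ-≤ {z} {x} {y} 0≤z x≤y yz<xz = <-irrefl (trans (*z≈0 y) (sym (*z≈0 x))) yz<xz
    where
    z≈0 : z ≈ 0#
    z≈0 = ≤-antisym (λ z>0 → x≤y (*-cancelʳ-< z>0 yz<xz)) 0≤z
    *z≈0 : ∀ w → w * z ≈ 0#
    *z≈0 w = trans (*-congˡ z≈0) (zeroʳ w)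

  *-monoˡ-≤ : 0# ≤ z → x ≤ y → z * x ≤ z * y
  *-monoˡ-≤ {z} {x} {y} 0≤z x≤y = begin
    z * x  ≈⟨ *-comm z x ⟩
    x * z  ≤⟨ *-monoʳ-≤ 0≤z x≤y ⟩
    y * z  ≈⟨ *-comm y z ⟩
    z * y  ∎

  *-nonNegative : 0# ≤ x → 0# ≤ y → 0# ≤ x * y
  *-nonNegative {x} {y} 0≤x 0≤y = begin
    0#      ≈⟨ zeroˡ y ⟨
    0# * y  ≤⟨ *-monoʳ-≤ 0≤y 0≤x ⟩
    x * y   ∎

  0≤1 : 0# ≤ 1#
  0≤1 = <-asym 0<1

  1-x-nonNegative : x ≤ 1# → 0# ≤ 1# - x
  1-x-nonNegative {x} x≤1 = begin
    0#      ≈⟨ -‿inverseʳ x ⟨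
    x - x   ≤⟨ +-monoˡ-≤ (- x) x≤1 ⟩
    1# - x  ∎

  x+[1-x]≈1 : ∀ x → x + (1# - x) ≈ 1#
  x+[1-x]≈1 x = trans (+-congˡ (+-comm 1# (- x)))
    (trans (sym (+-assoc x (- x) 1#)) (trans (+-congʳ (-‿inverseʳ x)) (+-identityˡ 1#)))

  fromℕ-+ : ∀ m n → fromℕ (m ℕ.+ n) ≈ fromℕ m + fromℕ n
  fromℕ-+ m n = ×-homo-+ 1# m n

  fromℕ-* : ∀ m n → fromℕ (m ℕ.* n) ≈ fromℕ m * fromℕ n
  fromℕ-* = ×1-homo-*

  fromℕ-nonNegative : ∀ n → 0# ≤ fromℕ n
  fromℕ-nonNegative zero    = ≤-refl
  fromℕ-nonNegative (suc n) = <-asym (fromℕ-positive n)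

  fromℕ-mono-≤ : ∀ {m n} → m ℕ.≤ n → fromℕ m ≤ fromℕ n
  fromℕ-mono-≤ {n = n} ℕ.z≤n = fromℕ-nonNegative n
  fromℕ-mono-≤ (ℕ.s≤s m≤n) = +-monoʳ-≤ 1# (fromℕ-mono-≤ m≤n)

  ½+½≈1 : ½ + ½ ≈ 1#
  ½+½≈1 = trans (solve 1 (λ h → h :+ h := (con 1 :+ (con 1 :+ con 0)) :* h) refl ½) (*-recip _ _)

  Σ-cong : ∀ n {f g} → (∀ t → f t ≈ g t) → Σ[ n ] f ≈ Σ[ n ] g
  Σ-cong zero    f≈g = refl
  Σ-cong (suc n) f≈g = +-cong (Σ-cong n f≈g) (f≈g n)

  Σ-zero : ∀ n {f} → (∀ t → f t ≈ 0#) → Σ[ n ] f ≈ 0#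
  Σ-zero zero    f≈0 = refl
  Σ-zero (suc n) f≈0 = trans (+-cong (Σ-zero n f≈0) (f≈0 n)) (+-identityʳ 0#)

  Σ-+ : ∀ n f g → Σ[ n ] (λ t → f t + g t) ≈ Σ[ n ] f + Σ[ n ] g
  Σ-+ zero    f g = sym (+-identityʳ 0#)
  Σ-+ (suc n) f g = trans (+-congʳ (Σ-+ n f g))
    (solve 4 (λ a b c d → (a :+ b) :+ (c :+ d) := (a :+ c) :+ (b :+ d)) refl _ _ (f n) (g n))

  Σ-head : ∀ n f → Σ[ suc n ] f ≈ f 0 + Σ[ n ] (f ∘ suc)
  Σ-head zero    f = +-comm 0# (f 0)
  Σ-head (suc n) f = trans (+-congʳ (Σ-head n f)) (+-assoc _ _ _)

  -- Bounds from above only. The error bounds for which it serves are non-negative, so for them this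
  -- is convergence to zero.
  Null : (ℕ → Carrier) → Set _
  Null g = ∀ ε → Positive ε → ∃[ N ] ∀ n → N ℕ.≤ n → g n < ε

  [x-ε]+ε≈x : ∀ x ε → (x - ε) + ε ≈ x
  [x-ε]+ε≈x x ε = trans (+-assoc x (- ε) ε) (trans (+-congˡ (-‿inverseˡ ε)) (+-identityʳ x))

  x<y+ε⇒x-ε<y : x < y + ε → x - ε < y
  x<y+ε⇒x-ε<y {x} {y} {ε} x<y+ε = +-cancelˡ-< ε (begin-strict
    ε + (x - ε)  ≈⟨ +-comm ε _ ⟩
    (x - ε) + ε  ≈⟨ [x-ε]+ε≈x x ε ⟩
    x            <⟨ x<y+ε ⟩
    y + ε        ≈⟨ +-comm y ε ⟩
    ε + y        ∎)

  x<x+ε : Positive ε → x < x + ε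
  x<x+ε {ε} {x} ε>0 = <-respˡ-≈ (+-identityʳ x) (+-monoʳ-< x ε>0)

  -- If `y < x`, half of the gap `x - y` is a positive `ε` with `y + ε < x`; the whole gap would not
  -- give a strict inequality.
  x≤y+ε⇒x≤y : (∀ ε → Positive ε → x ≤ y + ε) → x ≤ y
  x≤y+ε⇒x≤y {x} {y} x≤y+ε y<x = x≤y+ε (d * ½) (*-positive d>0 ½-positive) (begin-strict
    y + d * ½          <⟨ +-monoʳ-< y d½<d ⟩
    y + d              ≈⟨ +-comm y d ⟩
    (x - y) + y        ≈⟨ [x-ε]+ε≈x x y ⟩
    x                  ∎)
    where
    d = x - y
    d>0 : Positive d
    d>0 = +-cancelˡ-< y (begin-strict
      y + 0#       ≈⟨ +-identityʳ y ⟩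
      y            <⟨ y<x ⟩
      x            ≈⟨ [x-ε]+ε≈x x y ⟨
      (x - y) + y  ≈⟨ +-comm _ y ⟩
      y + (x - y)  ∎)
    d½<d : d * ½ < d
    d½<d = <-respˡ-≈ (*-comm ½ d) (<-respʳ-≈ (*-identityˡ d) (*-monoˡ-< d>0 ½<1))

  convergesTo-squeeze : ∀ f g → Null g → (∀ n → f n ≤ x) → (∀ n → x ≤ f n + g n) → ConvergesTo f x
  convergesTo-squeeze {x} f g g→0 f≤x x≤f+g ε ε>0 with N , small ← g→0 ε ε>0 =
    N , λ n N≤n →
      x<y+ε⇒x-ε<y (≤-<-trans (x≤f+g n) (+-monoʳ-< (f n) (small n N≤n)))
    , ≤-<-trans (f≤x n) (x<x+ε ε>0)

  limit≤ : ∀ f → ConvergesTo f x → (∀ n → f n ≤ y) → x ≤ y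
  limit≤ {x} {y} f f→x f≤y = x≤y+ε⇒x≤y λ ε ε>0 →
    let N , near = f→x ε ε>0 in begin
      x             ≈⟨ [x-ε]+ε≈x x ε ⟨
      (x - ε) + ε   ≤⟨ +-monoˡ-≤ ε (<-asym (proj₁ (near N ℕ.≤-refl))) ⟩
      f N + ε       ≤⟨ +-monoˡ-≤ ε (f≤y N) ⟩
      y + ε         ∎

  antitone : ∀ (f : ℕ → Carrier) → (∀ n → f (suc n) ≤ f n) → ∀ {m n} → m ℕ.≤ n → f n ≤ f m
  antitone f anti {m} m≤n = go (ℕ.≤⇒≤′ m≤n)
    where
    go : ∀ {n} → m ℕ.≤′ n → f n ≤ f m
    go ℕ.≤′-refl       = ≤-refl
    go (ℕ.≤′-step m≤n) = ≤-trans (anti _) (go m≤n)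

  monotone : ∀ (f : ℕ → Carrier) → (∀ n → f n ≤ f (suc n)) → ∀ {m n} → m ℕ.≤ n → f m ≤ f n
  monotone f mono {m} m≤n = go (ℕ.≤⇒≤′ m≤n)
    where
    go : ∀ {n} → m ℕ.≤′ n → f m ≤ f n
    go ℕ.≤′-refl       = ≤-refl
    go (ℕ.≤′-step m≤n) = ≤-trans (go m≤n) (mono _)

  -- The intervals from `f n` to `f n + g n` are nested and shrink to length zero, so `f` is Cauchy.
  -- `Cauchy` ranges over both orders of `m` and `n`, hence a one-sided estimate is enough.
  converges-squeeze : ∀ f g → Null g → (∀ n → 0# ≤ g n) → (∀ n → f n ≤ f (suc n)) →
    (∀ n → f (suc n) + g (suc n) ≤ f n + g n) → ∃[ x ] ConvergesTo f x
  converges-squeeze f g g→0 0≤g f↑ f+g↓ = complete f cauchy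
    where
    cauchy : Cauchy f
    cauchy ε ε>0 with N , small ← g→0 ε ε>0 = N , λ m n N≤m N≤n → begin-strict
      f m        ≤⟨ x≤x+y (0≤g m) ⟩
      f m + g m  ≤⟨ antitone (λ k → f k + g k) f+g↓ N≤m ⟩
      f N + g N  <⟨ +-monoʳ-< (f N) (small N ℕ.≤-refl) ⟩
      f N + ε    ≤⟨ +-monoˡ-≤ ε (monotone f f↑ N≤n) ⟩
      f n + ε    ∎

  infixl 6 _⊔_
  -- The axioms supply binary infima, from which suprema arise by negation.
  _⊔_ : Carrier → Carrier → Carrier
  x ⊔ y = - (- x ⊓ - y)

  -⊓≤ : ∀ {w} → w ≤ - x → x ≤ - w
  -⊓≤ {x} w≤-x = ≤-trans (≤-reflexive (sym (-‿involutive x))) (neg-antimono-≤ w≤-x)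

  x≤x⊔y : ∀ x y → x ≤ x ⊔ y
  x≤x⊔y x y = -⊓≤ (proj₁ (⊓-infimum (- x) (- y)))

  y≤x⊔y : ∀ x y → y ≤ x ⊔ y
  y≤x⊔y x y = -⊓≤ (proj₁ (proj₂ (⊓-infimum (- x) (- y))))

  ⊔-least : x ≤ z → y ≤ z → x ⊔ y ≤ z
  ⊔-least {x} {z} {y} x≤z y≤z = ≤-trans
    (neg-antimono-≤ (proj₂ (proj₂ (⊓-infimum (- x) (- y))) (- z) (neg-antimono-≤ x≤z) (neg-antimono-≤ y≤z)))
    (≤-reflexive (-‿involutive z))

  -- A labeling is a vector of signs, so the maximum over all labelings branches on one label at a
  -- time. It is a supremum; no maximizing labeling is singled out, as the order is not assumed
  -- decidable.
  max : ∀ {n} → (Vec Sign n → Carrier) → Carrier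
  max {zero}  f = f []
  max {suc n} f = max (f ∘ (Sign.+ ∷_)) ⊔ max (f ∘ (Sign.- ∷_))

  ≤-max : ∀ {n} (f : Vec Sign n → Carrier) s → f s ≤ max f
  ≤-max f []           = ≤-refl
  ≤-max f (Sign.+ ∷ s) = ≤-trans (≤-max (f ∘ (Sign.+ ∷_)) s) (x≤x⊔y _ _)
  ≤-max f (Sign.- ∷ s) = ≤-trans (≤-max (f ∘ (Sign.- ∷_)) s) (y≤x⊔y _ _)

  max-least : ∀ {n} (f : Vec Sign n → Carrier) {b} → (∀ s → f s ≤ b) → max f ≤ b
  max-least {zero}  f f≤b = f≤b []
  max-least {suc n} f f≤b = ⊔-least (max-least _ (f≤b ∘ (Sign.+ ∷_))) (max-least _ (f≤b ∘ (Sign.- ∷_)))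

  1/1+-nonNegative : ∀ n → 0# ≤ 1/1+ n
  1/1+-nonNegative n = <-asym (recip-positive _ _)

  [1+n]*1/1+n≈1 : ∀ n → fromℕ (suc n) * 1/1+ n ≈ 1#
  [1+n]*1/1+n≈1 n = *-recip _ _

  -- The Archimedean axiom provides an `N` above `K / ε`; multiplying by `fromℕ (suc n)` clears the
  -- denominator.
  1/1+-null : ∀ K → Null (λ n → K * 1/1+ n)
  1/1+-null K ε ε>0 with N , K/ε<N ← archimedean (K * recip ε ε>0) =
    N , λ n N≤n → *-cancelʳ-< (fromℕ-positive n) (begin-strict
      K * 1/1+ n * fromℕ (suc n)          ≈⟨ solve 3 (λ k w m → k :* w :* m := k :* (m :* w)) refl K (1/1+ n) _ ⟩
      K * (fromℕ (suc n) * 1/1+ n)        ≈⟨ *-congˡ ([1+n]*1/1+n≈1 n) ⟩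
      K * 1#                              ≈⟨ *-congˡ (*-recip ε ε>0) ⟨
      K * (ε * recip ε ε>0)               ≈⟨ solve 3 (λ k e r → k :* (e :* r) := k :* r :* e) refl K ε _ ⟩
      K * recip ε ε>0 * ε                 <⟨ *-monoˡ-< ε>0 K/ε<N ⟩
      fromℕ N * ε                         ≤⟨ *-monoʳ-≤ (<-asym ε>0) (fromℕ-mono-≤ (ℕ.≤-trans N≤n (ℕ.n≤1+n n))) ⟩
      fromℕ (suc n) * ε                   ≈⟨ *-comm _ _ ⟩
      ε * fromℕ (suc n)                   ∎)

-- Calculus of expectations over finitely supported distributions.

module Expectation {c ℓ₁ ℓ₂} (ℝ : RealNumbers c ℓ₁ ℓ₂)
  (p : RealNumbers.Carrier ℝ) (G : Graph) where

  open RealNumbers ℝ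
  open RealProperties ℝ
  open TriadDynamics ℝ p G
  open ≤-Reasoning

  private variable
    A B : Set
    μ ν : Dist A

  𝔼-cong : ∀ (μ : Dist A) {f g} → (∀ a → f a ≈ g a) → 𝔼 μ f ≈ 𝔼 μ g
  𝔼-cong []            f≈g = refl
  𝔼-cong ((w , a) ∷ μ) f≈g = +-cong (*-congˡ (f≈g a)) (𝔼-cong μ f≈g)

  𝔼-zero : ∀ (μ : Dist A) → 𝔼 μ (const 0#) ≈ 0#
  𝔼-zero []            = refl
  𝔼-zero ((w , a) ∷ μ) = trans (+-cong (zeroʳ w) (𝔼-zero μ)) (+-identityʳ 0#)

  𝔼-+ : ∀ (μ : Dist A) f g → 𝔼 μ (λ a → f a + g a) ≈ 𝔼 μ f + 𝔼 μ g
  𝔼-+ []            f g = sym (+-identityʳ 0#)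
  𝔼-+ ((w , a) ∷ μ) f g = trans (+-congˡ (𝔼-+ μ f g))
    (solve 5 (λ w x y X Y → w :* (x :+ y) :+ (X :+ Y) := (w :* x :+ X) :+ (w :* y :+ Y)) refl
      w (f a) (g a) _ _)

  𝔼-*ˡ : ∀ (μ : Dist A) x f → 𝔼 μ (λ a → x * f a) ≈ x * 𝔼 μ f
  𝔼-*ˡ []            x f = sym (zeroʳ x)
  𝔼-*ˡ ((w , a) ∷ μ) x f = trans (+-congˡ (𝔼-*ˡ μ x f))
    (solve 4 (λ w x y Y → w :* (x :* y) :+ x :* Y := x :* (w :* y :+ Y)) refl w x (f a) _)

  𝔼-Σ : ∀ (μ : Dist A) n (f : ℕ → A → Carrier) → 𝔼 μ (λ a → Σ[ n ] (λ t → f t a)) ≈ Σ[ n ] (λ t → 𝔼 μ (f t))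
  𝔼-Σ μ zero    f = 𝔼-zero μ
  𝔼-Σ μ (suc n) f = trans (𝔼-+ μ _ (f n)) (+-congʳ (𝔼-Σ μ n f))

  𝔼-++ : ∀ (μ ν : Dist A) f → 𝔼 (μ ++ ν) f ≈ 𝔼 μ f + 𝔼 ν f
  𝔼-++ []            ν f = sym (+-identityˡ _)
  𝔼-++ ((w , a) ∷ μ) ν f = trans (+-congˡ (𝔼-++ μ ν f)) (sym (+-assoc _ _ _))

  𝔼-scale : ∀ q (μ : Dist A) f → 𝔼 (scale q μ) f ≈ q * 𝔼 μ f
  𝔼-scale q []            f = sym (zeroʳ q)
  𝔼-scale q ((w , a) ∷ μ) f = trans (+-congˡ (𝔼-scale q μ f))
    (solve 4 (λ q w x Y → q :* w :* x :+ q :* Y := q :* (w :* x :+ Y)) refl q w (f a) _)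

  𝔼-bernoulli : ∀ q (μ ν : Dist A) f → 𝔼 (bernoulli q μ ν) f ≈ q * 𝔼 μ f + (1# - q) * 𝔼 ν f
  𝔼-bernoulli q μ ν f = trans (𝔼-++ (scale q μ) _ f) (+-cong (𝔼-scale q μ f) (𝔼-scale (1# - q) ν f))

  𝔼-pure : ∀ (a : A) f → 𝔼 (pure a) f ≈ f a
  𝔼-pure a f = trans (+-identityʳ _) (*-identityˡ (f a))

  𝔼->>= : ∀ (μ : Dist A) (k : A → Dist B) f → 𝔼 (μ >>= k) f ≈ 𝔼 μ (λ a → 𝔼 (k a) f)
  𝔼->>= []            k f = refl
  𝔼->>= ((w , a) ∷ μ) k f = trans (𝔼-++ (scale w (k a)) _ f) (+-cong (𝔼-scale w (k a) f) (𝔼->>= μ k f))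

  -- `Dist` admits arbitrary real weights. Non-negativity makes `𝔼` monotone, and writing the total
  -- mass as an expectation lets the rules for `𝔼` compute it.
  record IsProbability {A : Set} (μ : Dist A) : Set (c Level.⊔ ℓ₁ Level.⊔ ℓ₂) where
    field
      nonNegative : All (λ (w , _) → 0# ≤ w) μ
      mass        : 𝔼 μ (const 1#) ≈ 1#

  open IsProbability

  -- Comparison is required at the listed outcomes only: the drift estimate holds for imbalanced
  -- triangles and for their own edges, not for arbitrary triples and edges.
  𝔼-mono-All : IsProbability μ → ∀ {f g} → All (λ (_ , a) → f a ≤ g a) μ → 𝔼 μ f ≤ 𝔼 μ g
  𝔼-mono-All μ-prob = go (nonNegative μ-prob)
    where
    go : ∀ {f g} → All (λ (w , _) → 0# ≤ w) μ → All (λ (_ , a) → f a ≤ g a) μ → 𝔼 μ f ≤ 𝔼 μ g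
    go []          []            = ≤-refl
    go (0≤w ∷ 0≤μ) (fa≤ga ∷ f≤g) = +-mono-≤ (*-monoˡ-≤ 0≤w fa≤ga) (go 0≤μ f≤g)

  𝔼-mono : IsProbability μ → ∀ {f g} → (∀ a → f a ≤ g a) → 𝔼 μ f ≤ 𝔼 μ g
  𝔼-mono {μ = μ} μ-prob f≤g = 𝔼-mono-All μ-prob (All.universal (λ (_ , a) → f≤g a) μ)

  𝔼-const : IsProbability μ → ∀ x → 𝔼 μ (const x) ≈ x
  𝔼-const {μ = μ} μ-prob x =
    trans (𝔼-cong μ (λ _ → sym (*-identityʳ x)))
      (trans (𝔼-*ˡ μ x (const 1#)) (trans (*-congˡ (mass μ-prob)) (*-identityʳ x)))

  pure-isProbability : ∀ (a : A) → IsProbability (pure a)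
  pure-isProbability a = record { nonNegative = 0≤1 ∷ [] ; mass = 𝔼-pure a _ }

  uniform-isProbability : ∀ (xs : List⁺ A) → IsProbability (uniform xs)
  uniform-isProbability (x ∷ xs) = record
    { nonNegative = All.map⁺ (All.universal (λ _ → 1/1+-nonNegative (length xs)) (x ∷ xs))
    ; mass        = trans (equal-weights (x ∷ xs)) ([1+n]*1/1+n≈1 (length xs))
    }
    where
    equal-weights : ∀ {w} (ys : List A) → 𝔼 (List.map (w ,_) ys) (const 1#) ≈ fromℕ (length ys) * w
    -- The weight is a variable because it is fixed by the length of the full list, while the
    -- induction shortens the list.
    equal-weights {w = w} []       = sym (zeroˡ w)
    equal-weights {w = w} (_ ∷ ys) = trans (+-congˡ (equal-weights ys))
      (solve 2 (λ w n → w :* con 1 :+ n :* w := (con 1 :+ n) :* w) refl w _)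

  scale-nonNegative : ∀ {q} → 0# ≤ q → All (λ (w , _) → 0# ≤ w) μ → All (λ (w , _) → 0# ≤ w) (scale q μ)
  scale-nonNegative 0≤q 0≤μ = All.map⁺ (All.map (*-nonNegative 0≤q) 0≤μ)

  bernoulli-isProbability : ∀ {q} → 0# ≤ q → q ≤ 1# →
    IsProbability μ → IsProbability ν → IsProbability (bernoulli q μ ν)
  bernoulli-isProbability {μ = μ} {ν = ν} {q} 0≤q q≤1 μ-prob ν-prob = record
    { nonNegative = All.++⁺ (scale-nonNegative 0≤q (nonNegative μ-prob))
        (scale-nonNegative (1-x-nonNegative q≤1) (nonNegative ν-prob))
    ; mass        = trans (𝔼-bernoulli q μ ν _)
        (trans (+-cong (trans (*-congˡ (mass μ-prob)) (*-identityʳ q))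
                       (trans (*-congˡ (mass ν-prob)) (*-identityʳ (1# - q))))
               (x+[1-x]≈1 q))
    }

  >>=-isProbability : ∀ {k : A → Dist B} → IsProbability μ → (∀ a → IsProbability (k a)) →
    IsProbability (μ >>= k)
  >>=-isProbability {μ = μ} {k = k} μ-prob k-prob = record
    { nonNegative = go (nonNegative μ-prob)
    ; mass        = trans (𝔼->>= μ k _) (trans (𝔼-cong μ (mass ∘ k-prob)) (mass μ-prob))
    }
    where
    go : ∀ {μ} → All (λ (w , _) → 0# ≤ w) μ → All (λ (w , _) → 0# ≤ w) (μ >>= k)
    go []                      = []
    go (_∷_ {x = _ , a} 0≤w 0≤μ) = All.++⁺ (scale-nonNegative 0≤w (nonNegative (k-prob a))) (go 0≤μ)

-- If 1 + Φ ≤ M, the probability of needing at least n steps is at most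
-- D n * (1 + Φ), which decays like 1/n³.  It would even decay geometrically,
-- but with these weights the series for the expectation telescopes, since
-- w n * w (1 + n) = w n - w (1 + n).
module HarmonicWeights {c ℓ₁ ℓ₂} (ℝ : RealNumbers c ℓ₁ ℓ₂) (M : ℕ) where

  open RealNumbers ℝ
  open RealProperties ℝ
  open ≤-Reasoning

  -- The offset `3 M` ensures `3 φ ≤ y n` for all `n` as soon as `φ ≤ M`, which is what `w-decay`
  -- needs.
  a : ℕ
  a = M ℕ.+ (M ℕ.+ M)

  y w : ℕ → Carrier
  y t = fromℕ (suc (t ℕ.+ a))
  w t = 1/1+ (t ℕ.+ a)

  -- Normalizes `D 0` to 1, the trivial bound from which the induction in `1≤H+D` starts.
  K : Carrier
  K = y 0 * y 1 * y 2

  D : ℕ → Carrier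
  D n = K * (w n * (w (1 ℕ.+ n) * w (2 ℕ.+ n)))

  yw≈1 : ∀ t → y t * w t ≈ 1#
  yw≈1 t = [1+n]*1/1+n≈1 (t ℕ.+ a)

  0≤y : ∀ t → 0# ≤ y t
  0≤y t = fromℕ-nonNegative (suc (t ℕ.+ a))

  0≤w : ∀ t → 0# ≤ w t
  0≤w t = 1/1+-nonNegative (t ℕ.+ a)

  K-nonNegative : 0# ≤ K
  K-nonNegative = *-nonNegative (*-nonNegative (0≤y 0) (0≤y 1)) (0≤y 2)

  D-nonNegative : ∀ n → 0# ≤ D n
  D-nonNegative n = *-nonNegative K-nonNegative
    (*-nonNegative (0≤w n) (*-nonNegative (0≤w (1 ℕ.+ n)) (0≤w (2 ℕ.+ n))))

  D0≈1 : D 0 ≈ 1#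
  D0≈1 = trans
    (solve 6 (λ x y z u v w → x :* y :* z :* (u :* (v :* w)) := (x :* u) :* ((y :* v) :* (z :* w))) refl
      (y 0) (y 1) (y 2) (w 0) (w 1) (w 2))
    (trans (*-cong (yw≈1 0) (*-cong (yw≈1 1) (yw≈1 2))) (trans (*-identityˡ _) (*-identityˡ 1#)))

  -- Multiplied by `y n` and `y (3 + n)`, the claim becomes `φ * (y n + 3) ≤ (1 + φ) * y n`, that
  -- is, `3 φ ≤ y n`.
  w-decay : ∀ n {φ} → φ ≤ fromℕ M → φ * w n ≤ (1# + φ) * w (3 ℕ.+ n)
  w-decay n {φ} φ≤M = *-cancelʳ-≤ (fromℕ-positive (n ℕ.+ a)) (*-cancelʳ-≤ (fromℕ-positive (3 ℕ.+ n ℕ.+ a)) (begin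
    φ * w n * y n * y (3 ℕ.+ n)
      ≈⟨ solve 4 (λ φ w y z → φ :* w :* y :* z := φ :* z :* (y :* w)) refl φ (w n) (y n) _ ⟩
    φ * y (3 ℕ.+ n) * (y n * w n)
      ≈⟨ trans (*-congˡ (yw≈1 n)) (*-identityʳ _) ⟩
    φ * y (3 ℕ.+ n)
      ≈⟨ solve 2 (λ φ y → φ :* (con 1 :+ (con 1 :+ (con 1 :+ y))) := φ :* y :+ (φ :+ (φ :+ φ))) refl φ (y n) ⟩
    φ * y n + (φ + (φ + φ))
      ≤⟨ +-monoʳ-≤ _ 3φ≤y ⟩
    φ * y n + y n
      ≈⟨ solve 2 (λ φ y → φ :* y :+ y := (con 1 :+ φ) :* y) refl φ (y n) ⟩
    (1# + φ) * y n
      ≈⟨ trans (*-congˡ (yw≈1 (3 ℕ.+ n))) (*-identityʳ _) ⟨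
    (1# + φ) * y n * (y (3 ℕ.+ n) * w (3 ℕ.+ n))
      ≈⟨ solve 4 (λ φ w y z → φ :* y :* (z :* w) := φ :* w :* y :* z) refl (1# + φ) _ (y n) (y (3 ℕ.+ n)) ⟩
    (1# + φ) * w (3 ℕ.+ n) * y n * y (3 ℕ.+ n) ∎))
    where
    3φ≤y : φ + (φ + φ) ≤ y n
    3φ≤y = begin
      φ + (φ + φ)                          ≤⟨ +-mono-≤ φ≤M (+-mono-≤ φ≤M φ≤M) ⟩
      fromℕ M + (fromℕ M + fromℕ M)        ≈⟨ trans (fromℕ-+ M _) (+-congˡ (fromℕ-+ M M)) ⟨
      fromℕ a                              ≤⟨ fromℕ-mono-≤ (ℕ.≤-trans (ℕ.m≤n+m a n) (ℕ.n≤1+n _)) ⟩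
      y n                                  ∎

  -- `D n` and `D (suc n)` share the factors `w (1 + n)` and `w (2 + n)`; `w-decay` compares the
  -- remaining ones. This pays for one step of the dynamics, where the drift has turned an average
  -- of `1 + Φ` into `Φ`.
  D-decay : ∀ n {φ} → φ ≤ fromℕ M → D n * φ ≤ D (suc n) * (1# + φ)
  D-decay n {φ} φ≤M = begin
    D n * φ
      ≈⟨ solve 5 (λ k x y z φ → k :* (x :* (y :* z)) :* φ := k :* (y :* z) :* (φ :* x)) refl K (w n) _ _ φ ⟩
    K * (w (1 ℕ.+ n) * w (2 ℕ.+ n)) * (φ * w n)
      ≤⟨ *-monoˡ-≤ (*-nonNegative K-nonNegative (*-nonNegative (0≤w (1 ℕ.+ n)) (0≤w (2 ℕ.+ n)))) (w-decay n φ≤M) ⟩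
    K * (w (1 ℕ.+ n) * w (2 ℕ.+ n)) * ((1# + φ) * w (3 ℕ.+ n))
      ≈⟨ solve 5 (λ k x y z φ → k :* (x :* y) :* (φ :* z) := k :* (x :* (y :* z)) :* φ) refl K _ _ _ _ ⟩
    D (suc n) * (1# + φ) ∎

  n*w≤1 : ∀ {m} n → m ℕ.≤ suc (n ℕ.+ a) → fromℕ m * w n ≤ 1#
  n*w≤1 n m≤n = ≤-trans (*-monoʳ-≤ (0≤w n) (fromℕ-mono-≤ m≤n)) (≤-reflexive (yw≈1 n))

  w≤1 : ∀ n → w n ≤ 1#
  w≤1 n = begin
    w n            ≈⟨ trans (*-congʳ (+-identityʳ 1#)) (*-identityˡ (w n)) ⟨
    fromℕ 1 * w n  ≤⟨ n*w≤1 {1} n (ℕ.s≤s ℕ.z≤n) ⟩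
    1#             ∎

  D≤K*w : ∀ n → D n ≤ K * w n
  D≤K*w n = begin
    K * (w n * (w (1 ℕ.+ n) * w (2 ℕ.+ n)))
      ≤⟨ *-monoˡ-≤ K-nonNegative (*-monoˡ-≤ (0≤w n) (≤-trans (*-monoʳ-≤ (0≤w (2 ℕ.+ n)) (w≤1 (1 ℕ.+ n))) (*-monoˡ-≤ 0≤1 (w≤1 (2 ℕ.+ n))))) ⟩
    K * (w n * (1# * 1#))
      ≈⟨ solve 2 (λ k x → k :* (x :* (con 1 :* con 1)) := k :* x) refl K (w n) ⟩
    K * w n ∎

  -- Since `n * w (2 + n) ≤ 1`, the term `n * D n` is at most `K * (w n * w (1 + n))`, which is the
  -- difference of `K * w n` and `K * w (1 + n)`.
  n*D+K*w≤K*w : ∀ n → fromℕ n * D n + K * w (suc n) ≤ K * w n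
  n*D+K*w≤K*w n = begin
    fromℕ n * D n + K * w (suc n)
      ≈⟨ +-congʳ (solve 5 (λ m k x y z → m :* (k :* (x :* (y :* z))) := k :* (x :* y) :* (m :* z)) refl (fromℕ n) K (w n) _ _) ⟩
    K * (w n * w (1 ℕ.+ n)) * (fromℕ n * w (2 ℕ.+ n)) + K * w (suc n)
      ≤⟨ +-monoˡ-≤ _ (*-monoˡ-≤ (*-nonNegative K-nonNegative (*-nonNegative (0≤w n) (0≤w (1 ℕ.+ n))))
           (n*w≤1 (2 ℕ.+ n) (ℕ.≤-trans (ℕ.m≤m+n n a) (ℕ.m≤n+m _ 3)))) ⟩
    K * (w n * w (1 ℕ.+ n)) * 1# + K * w (suc n)
      -- Inserting `y n * w n`, which is 1, gives both terms a common denominator with numerator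
      -- `1 + y n`, and this is `y (suc n)` by definition.
      ≈⟨ +-congˡ (trans (*-congˡ (*-congʳ (yw≈1 n))) (*-congˡ (*-identityˡ _))) ⟨
    K * (w n * w (1 ℕ.+ n)) * 1# + K * (y n * w n * w (suc n))
      ≈⟨ solve 4 (λ k x z y → k :* (x :* z) :* con 1 :+ k :* (y :* x :* z) := k :* x :* ((con 1 :+ y) :* z)) refl K (w n) (w (suc n)) (y n) ⟩
    K * w n * (y (suc n) * w (suc n))
      ≈⟨ trans (*-congˡ (yw≈1 (suc n))) (*-identityʳ _) ⟩
    K * w n ∎

-- From a drift condition to bounded expected hitting times.

module ExpectedHittingTime {c ℓ₁ ℓ₂} (ℝ : RealNumbers c ℓ₁ ℓ₂) {p : RealNumbers.Carrier ℝ}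
  (0≤p : RealNumbers._≤_ ℝ (RealNumbers.0# ℝ) p) (p≤1 : RealNumbers._≤_ ℝ p (RealNumbers.1# ℝ))
  (G : Graph) where

  open RealNumbers ℝ
  open RealProperties ℝ
  open TriadDynamics ℝ p G
  open Expectation ℝ p G
  open ≤-Reasoning

  chooseEdge-isProbability : ∀ σ T → IsProbability (chooseEdge σ T)
  chooseEdge-isProbability (Sign.- , Sign.+ , Sign.+) (a , b , c) =
    bernoulli-isProbability 0≤p p≤1 (pure-isProbability a) (uniform-isProbability (b ∷ c ∷ []))
  chooseEdge-isProbability (Sign.+ , Sign.- , Sign.+) (a , b , c) =
    bernoulli-isProbability 0≤p p≤1 (pure-isProbability b) (uniform-isProbability (a ∷ c ∷ []))
  chooseEdge-isProbability (Sign.+ , Sign.+ , Sign.-) (a , b , c) =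
    bernoulli-isProbability 0≤p p≤1 (pure-isProbability c) (uniform-isProbability (a ∷ b ∷ []))
  chooseEdge-isProbability (Sign.+ , Sign.+ , Sign.+) (a , b , c) = uniform-isProbability _
  chooseEdge-isProbability (Sign.+ , Sign.- , Sign.-) (a , b , c) = uniform-isProbability _
  chooseEdge-isProbability (Sign.- , Sign.+ , Sign.-) (a , b , c) = uniform-isProbability _
  chooseEdge-isProbability (Sign.- , Sign.- , Sign.+) (a , b , c) = uniform-isProbability _
  chooseEdge-isProbability (Sign.- , Sign.- , Sign.-) (a , b , c) = uniform-isProbability _

  step-isProbability : ∀ s → IsProbability (step s)
  step-isProbability s with imbalancedTriangles s
  ... | []     = pure-isProbability s
  ... | T ∷ Ts = >>=-isProbability (uniform-isProbability (T ∷ Ts)) λ T′ →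
    >>=-isProbability (chooseEdge-isProbability (labels s T′) T′) λ e → pure-isProbability (flip e s)

  -- This and the next three equations resolve the `with` inside `hitsAt` from an equation about
  -- `imbalancedTriangles s`.
  hitsAt-zero-[] : ∀ s → imbalancedTriangles s ≡ [] → hitsAt 0 s ≡ 1#
  hitsAt-zero-[] s eq with imbalancedTriangles s | eq
  ... | [] | _ = ≡.refl

  hitsAt-suc-[] : ∀ t s → imbalancedTriangles s ≡ [] → hitsAt (suc t) s ≡ 0#
  hitsAt-suc-[] t s eq with imbalancedTriangles s | eq
  ... | [] | _ = ≡.refl

  hitsAt-zero-∷ : ∀ s {T Ts} → imbalancedTriangles s ≡ T ∷ Ts → hitsAt 0 s ≡ 0#
  hitsAt-zero-∷ s eq with imbalancedTriangles s | eq
  ... | _ ∷ _ | _ = ≡.refl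

  hitsAt-suc-∷ : ∀ t s {T Ts} → imbalancedTriangles s ≡ T ∷ Ts → hitsAt (suc t) s ≡ 𝔼 (step s) (hitsAt t)
  hitsAt-suc-∷ t s = unfold step (λ _ → ≡.refl) s
    where
    -- A name for the step that abstracting over imbalancedTriangles s
    -- cannot unfold.
    unfold : ∀ step′ → (∀ s → step s ≡ step′ s) → ∀ s {T Ts} → imbalancedTriangles s ≡ T ∷ Ts →
      hitsAt (suc t) s ≡ 𝔼 (step′ s) (hitsAt t)
    unfold step′ step≡step′ s eq with imbalancedTriangles s | eq
    ... | _ ∷ _ | _ = ≡.cong (λ μ → 𝔼 μ (hitsAt t)) (step≡step′ s)

  -- General weights treat both series of `HasExpectedTime` at once: `const 1#` gives the
  -- probability of hitting before time `n`, `fromℕ` the truncated expectation. Conditioning on the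
  -- first step turns `f` into `f ∘ suc`.
  S : (ℕ → Carrier) → ℕ → Labeling → Carrier
  S f n s = Σ[ n ] λ t → f t * hitsAt t s

  S-[] : ∀ f n s → imbalancedTriangles s ≡ [] → S f (suc n) s ≈ f 0
  S-[] f n s eq = trans (Σ-head n _) (trans
    (+-cong (trans (*-congˡ (reflexive (hitsAt-zero-[] s eq))) (*-identityʳ (f 0)))
      (Σ-zero n λ t → trans (*-congˡ (reflexive (hitsAt-suc-[] t s eq))) (zeroʳ (f (suc t)))))
    (+-identityʳ (f 0)))

  S-∷ : ∀ f n s {T Ts} → imbalancedTriangles s ≡ T ∷ Ts →
    S f (suc n) s ≈ 𝔼 (step s) (S (f ∘ suc) n)
  S-∷ f n s eq = begin-equality
    S f (suc n) s
      ≈⟨ Σ-head n _ ⟩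
    f 0 * hitsAt 0 s + Σ[ n ] (λ t → f (suc t) * hitsAt (suc t) s)
      ≈⟨ +-cong (trans (*-congˡ (reflexive (hitsAt-zero-∷ s eq))) (zeroʳ (f 0)))
           (Σ-cong n λ t → trans (*-congˡ (reflexive (hitsAt-suc-∷ t s eq))) (sym (𝔼-*ˡ (step s) (f (suc t)) (hitsAt t)))) ⟩
    0# + Σ[ n ] (λ t → 𝔼 (step s) (λ s′ → f (suc t) * hitsAt t s′))
      ≈⟨ +-identityˡ _ ⟩
    Σ[ n ] (λ t → 𝔼 (step s) (λ s′ → f (suc t) * hitsAt t s′))
      ≈⟨ 𝔼-Σ (step s) n (λ t s′ → f (suc t) * hitsAt t s′) ⟨
    𝔼 (step s) (S (f ∘ suc) n) ∎

  hitsAt-nonNegative : ∀ t s → 0# ≤ hitsAt t s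
  hitsAt-nonNegative t s with imbalancedTriangles s in eq
  hitsAt-nonNegative zero    s | []    = ≤-trans 0≤1 (≤-reflexive (reflexive (≡.sym (hitsAt-zero-[] s eq))))
  hitsAt-nonNegative (suc t) s | []    = ≤-reflexive (reflexive (≡.sym (hitsAt-suc-[] t s eq)))
  hitsAt-nonNegative zero    s | _ ∷ _ = ≤-reflexive (reflexive (≡.sym (hitsAt-zero-∷ s eq)))
  hitsAt-nonNegative (suc t) s | _ ∷ _ = begin
    0#                              ≈⟨ 𝔼-zero (step s) ⟨
    𝔼 (step s) (const 0#)           ≤⟨ 𝔼-mono (step-isProbability s) (hitsAt-nonNegative t) ⟩
    𝔼 (step s) (hitsAt t)           ≡⟨ hitsAt-suc-∷ t s eq ⟨
    hitsAt (suc t) s                ∎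

  -- The Foster-Lyapunov condition, with the unit decrease put inside the expectation to avoid
  -- subtraction.
  Drift : (Labeling → Carrier) → Set _
  Drift Φ = ∀ s {T Ts} → imbalancedTriangles s ≡ T ∷ Ts → 𝔼 (step s) (λ s′ → 1# + Φ s′) ≤ Φ s

  module _ (Φ : Labeling → Carrier) (Φ-nonNegative : ∀ s → 0# ≤ Φ s) (drift : Drift Φ) where

    H F : ℕ → Labeling → Carrier
    H = S (const 1#)
    F = S fromℕ

    H≤1 : ∀ n s → H n s ≤ 1#
    H≤1 zero    s = 0≤1
    H≤1 (suc n) s with imbalancedTriangles s in eq
    ... | []    = ≤-reflexive (S-[] _ n s eq)
    ... | _ ∷ _ = begin
      H (suc n) s            ≈⟨ S-∷ _ n s eq ⟩
      𝔼 (step s) (H n)       ≤⟨ 𝔼-mono (step-isProbability s) (H≤1 n) ⟩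
      𝔼 (step s) (const 1#)  ≈⟨ 𝔼-const (step-isProbability s) 1# ⟩
      1#                     ∎

    -- Shifting the weight from `t` to `t + 1` splits off `H n`, which is at most 1; the drift
    -- condition pays for exactly this unit.
    F≤Φ : ∀ n s → F n s ≤ Φ s
    F≤Φ zero    s = Φ-nonNegative s
    F≤Φ (suc n) s with imbalancedTriangles s in eq
    ... | []    = ≤-trans (≤-reflexive (S-[] _ n s eq)) (Φ-nonNegative s)
    ... | _ ∷ _ = begin
      F (suc n) s                          ≈⟨ S-∷ _ n s eq ⟩
      𝔼 (step s) (S (fromℕ ∘ suc) n)       ≈⟨ 𝔼-cong (step s) split ⟩
      𝔼 (step s) (λ s′ → H n s′ + F n s′)  ≤⟨ 𝔼-mono (step-isProbability s) (λ s′ → +-mono-≤ (H≤1 n s′) (F≤Φ n s′)) ⟩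
      𝔼 (step s) (λ s′ → 1# + Φ s′)        ≤⟨ drift s eq ⟩
      Φ s                                  ∎
      where
      split : ∀ s′ → S (fromℕ ∘ suc) n s′ ≈ H n s′ + F n s′
      split s′ = trans (Σ-cong n (λ t → distribʳ (hitsAt t s′) 1# (fromℕ t)))
        (Σ-+ n (λ t → 1# * hitsAt t s′) (λ t → fromℕ t * hitsAt t s′))

    module _ (M : ℕ) (1+Φ≤M : ∀ s → 1# + Φ s ≤ fromℕ M) where

      open HarmonicWeights ℝ M

      Φ≤M : ∀ s → Φ s ≤ fromℕ M
      Φ≤M s = ≤-trans (x≤y+x 0≤1) (1+Φ≤M s)

      1≤1+Φ : ∀ s → 1# ≤ 1# + Φ s
      1≤1+Φ s = x≤x+y (Φ-nonNegative s)

      -- Bounds the mass not absorbed before time `n`. Averaging the induction hypothesis over one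
      -- step leaves `D n` times the mean of `1 + Φ`; the drift lowers that mean to `Φ s`, and
      -- `D-decay` restores the form of the claim.
      1≤H+D : ∀ n s → 1# ≤ H n s + D n * (1# + Φ s)
      1≤H+D zero    s = begin
        1#                        ≤⟨ 1≤1+Φ s ⟩
        1# + Φ s                  ≈⟨ trans (*-congʳ D0≈1) (*-identityˡ _) ⟨
        D 0 * (1# + Φ s)          ≈⟨ +-identityˡ _ ⟨
        0# + D 0 * (1# + Φ s)     ∎
      1≤H+D (suc n) s with imbalancedTriangles s in eq
      ... | []    = begin
        1#                                    ≈⟨ S-[] _ n s eq ⟨
        H (suc n) s                           ≤⟨ x≤x+y (*-nonNegative (D-nonNegative (suc n)) (≤-trans 0≤1 (1≤1+Φ s))) ⟩
        H (suc n) s + D (suc n) * (1# + Φ s)  ∎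
      ... | _ ∷ _ = begin
        1#
          ≈⟨ 𝔼-const (step-isProbability s) 1# ⟨
        𝔼 (step s) (const 1#)
          ≤⟨ 𝔼-mono (step-isProbability s) (1≤H+D n) ⟩
        𝔼 (step s) (λ s′ → H n s′ + D n * (1# + Φ s′))
          ≈⟨ trans (𝔼-+ (step s) _ _) (+-cong (sym (S-∷ _ n s eq)) (𝔼-*ˡ (step s) (D n) _)) ⟩
        H (suc n) s + D n * 𝔼 (step s) (λ s′ → 1# + Φ s′)
          ≤⟨ +-monoʳ-≤ _ (*-monoˡ-≤ (D-nonNegative n) (drift s eq)) ⟩
        H (suc n) s + D n * Φ s
          ≤⟨ +-monoʳ-≤ _ (D-decay n (Φ≤M s)) ⟩
        H (suc n) s + D (suc n) * (1# + Φ s) ∎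

      hitsAt≤D : ∀ n s → hitsAt n s ≤ D n * fromℕ M
      hitsAt≤D n s = begin
        hitsAt n s          ≈⟨ *-identityˡ _ ⟨
        -- `H (suc n) s` is `H n s` plus this very term and is at most 1, so the term fits under the
        -- bound for the missing mass.
        1# * hitsAt n s     ≤⟨ +-cancelˡ-≤ (H n s) (≤-trans (H≤1 (suc n) s) (1≤H+D n s)) ⟩
        D n * (1# + Φ s)    ≤⟨ *-monoˡ-≤ (D-nonNegative n) (1+Φ≤M s) ⟩
        D n * fromℕ M       ∎

      -- One error bound for both series: it dominates the missing mass because `D n ≤ K * w n`, and
      -- the tail of the expectation by telescoping.
      g : ℕ → Carrier
      g n = K * fromℕ M * w n

      M-nonNegative : 0# ≤ fromℕ M
      M-nonNegative = fromℕ-nonNegative M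

      g-nonNegative : ∀ n → 0# ≤ g n
      g-nonNegative n = *-nonNegative (*-nonNegative K-nonNegative M-nonNegative) (0≤w n)

      g-null : Null g
      g-null ε ε>0 with N , small ← 1/1+-null (K * fromℕ M) ε ε>0 =
        N , λ n N≤n → small (n ℕ.+ a) (ℕ.≤-trans N≤n (ℕ.m≤m+n n a))

      g-scaled : ∀ n → g n ≈ K * w n * fromℕ M
      g-scaled n = solve 3 (λ k m w → k :* m :* w := k :* w :* m) refl K (fromℕ M) (w n)

      1≤H+g : ∀ n s → 1# ≤ H n s + g n
      1≤H+g n s = begin
        1#                          ≤⟨ 1≤H+D n s ⟩
        H n s + D n * (1# + Φ s)    ≤⟨ +-monoʳ-≤ _ (*-monoˡ-≤ (D-nonNegative n) (1+Φ≤M s)) ⟩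
        H n s + D n * fromℕ M       ≤⟨ +-monoʳ-≤ _ (*-monoʳ-≤ M-nonNegative (D≤K*w n)) ⟩
        H n s + K * w n * fromℕ M   ≈⟨ +-congˡ (g-scaled n) ⟨
        H n s + g n                 ∎

      F+g-antitone : ∀ n s → F (suc n) s + g (suc n) ≤ F n s + g n
      F+g-antitone n s = begin
        F n s + fromℕ n * hitsAt n s + g (suc n)
          ≤⟨ +-monoˡ-≤ _ (+-monoʳ-≤ _ (*-monoˡ-≤ (fromℕ-nonNegative n) (hitsAt≤D n s))) ⟩
        F n s + fromℕ n * (D n * fromℕ M) + g (suc n)
          ≈⟨ solve 6 (λ f n d m k w → f :+ n :* (d :* m) :+ k :* m :* w := f :+ (n :* d :+ k :* w) :* m) refl
               (F n s) (fromℕ n) (D n) (fromℕ M) K (w (suc n)) ⟩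
        F n s + (fromℕ n * D n + K * w (suc n)) * fromℕ M
          ≤⟨ +-monoʳ-≤ _ (*-monoʳ-≤ M-nonNegative (n*D+K*w≤K*w n)) ⟩
        F n s + K * w n * fromℕ M
          ≈⟨ +-congˡ (g-scaled n) ⟨
        F n s + g n ∎

      hitsAt-sumsTo-1 : ∀ s → SumsTo (λ t → hitsAt t s) 1#
      hitsAt-sumsTo-1 s = convergesTo-squeeze (λ n → Σ[ n ] (λ t → hitsAt t s)) g g-null
        (λ n → ≤-trans (≤-reflexive (sym (H≈ n))) (H≤1 n s))
        (λ n → ≤-trans (1≤H+g n s) (≤-reflexive (+-congʳ (H≈ n))))
        where
        H≈ : ∀ n → H n s ≈ Σ[ n ] (λ t → hitsAt t s)
        H≈ n = Σ-cong n (λ t → *-identityˡ (hitsAt t s))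

      F-converges : ∀ s → ∃[ e ] ConvergesTo (λ n → F n s) e
      F-converges s = converges-squeeze (λ n → F n s) g g-null g-nonNegative
        (λ n → x≤x+y (*-nonNegative (fromℕ-nonNegative n) (hitsAt-nonNegative n s)))
        (λ n → F+g-antitone n s)

      expectedTime-bounded : ∀ s → ∃[ e ] HasExpectedTime s e × e ≤ Φ s
      expectedTime-bounded s =
        let e , F→e = F-converges s in
        e , (hitsAt-sumsTo-1 s , F→e) , limit≤ (λ n → F n s) F→e (λ n → F≤Φ n s)

  -- The Archimedean `M` governs only how fast the series converge; the expected time itself is
  -- bounded by `Φ s`, hence by `b`.
  balanceTime-bounded : ∀ Φ {b} → (∀ s → 0# ≤ Φ s) → Drift Φ → (∀ s → Φ s ≤ b) →
    ∃[ τ ] IsBalanceTime τ × τ ≤ b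
  balanceTime-bounded Φ {b} 0≤Φ drift Φ≤b with M , 1+b<M ← archimedean (1# + b) =
    max (proj₁ ∘ time)
    , record
      { expectedTime = proj₁ ∘ time
      ; isExpected   = proj₁ ∘ proj₂ ∘ time
      ; upperBound   = ≤-max (proj₁ ∘ time)
      ; least        = λ _ → max-least (proj₁ ∘ time)
      }
    , max-least (proj₁ ∘ time) (λ s → ≤-trans (proj₂ (proj₂ (time s))) (Φ≤b s))
    where
    time : ∀ s → ∃[ e ] HasExpectedTime s e × e ≤ Φ s
    time = expectedTime-bounded Φ 0≤Φ drift M λ s → ≤-trans (+-monoʳ-≤ 1# (Φ≤b s)) (<-asym 1+b<M)

-- Sums of natural numbers over `Fin n`.

module FiniteSums where

  open ≡ using (refl; cong; trans)
  open Sum ℕ.+-0-commutativeMonoid using (sum; ∑-distrib-+)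

  -- The Kronecker delta. Added to one side of a pointwise inequality, it records a change by one at
  -- a single index without subtraction.
  δ : ∀ {n} → Fin n → Fin n → ℕ
  δ j i = if does (i Fin.≟ j) then 1 else 0

  sum-≤ : ∀ {n} {f g : Fin n → ℕ} → (∀ i → f i ℕ.≤ g i) → sum f ℕ.≤ sum g
  sum-≤ {zero}  f≤g = ℕ.z≤n
  sum-≤ {suc n} f≤g = ℕ.+-mono-≤ (f≤g zero) (sum-≤ (f≤g ∘ suc))

  sum-const : ∀ n k → sum {n} (const k) ≡ n ℕ.* k
  sum-const zero    k = refl
  sum-const (suc n) k = cong (k ℕ.+_) (sum-const n k)

  sum-δ : ∀ {n} (j : Fin n) → sum (δ j) ≡ 1
  sum-δ {suc n} zero = cong suc (trans (sum-const n 0) (ℕ.*-zeroʳ n))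
  sum-δ (suc j)      = sum-δ j

  sum-+δ : ∀ {n} (f : Fin n → ℕ) j → sum (λ i → f i ℕ.+ δ j i) ≡ sum f ℕ.+ 1
  sum-+δ f j = trans (∑-distrib-+ f (δ j)) (cong (sum f ℕ.+_) (sum-δ j))

  sum-+δ-≤ : ∀ {m} {f g : Fin m → ℕ} j → (∀ i → f i ℕ.+ δ j i ℕ.≤ g i) → sum f ℕ.+ 1 ℕ.≤ sum g
  sum-+δ-≤ {f = f} j f+δ≤g = ℕ.≤-trans (ℕ.≤-reflexive (≡.sym (sum-+δ f j))) (sum-≤ f+δ≤g)

-- The effect of an edge flip on the sign of a triangle.

module TriangleSigns {c ℓ₁ ℓ₂} (ℝ : RealNumbers c ℓ₁ ℓ₂) (p : RealNumbers.Carrier ℝ) (G : Graph) where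

  open Graph G
  open TriadDynamics ℝ p G using (Labeling; flip)
  open ≡ using (refl; sym; trans; ≢-sym)

  weight : Sign → ℕ
  weight Sign.+ = 0
  weight Sign.- = 1

  weight≤1 : ∀ σ → weight σ ℕ.≤ 1
  weight≤1 Sign.+ = ℕ.z≤n
  weight≤1 Sign.- = ℕ.≤-refl

  triangleSign : Labeling → Triple → Sign
  triangleSign s (a , b , c) = lookup s a Sign.* lookup s b Sign.* lookup s c

  flip-≡ : ∀ e s → lookup (flip e s) e ≡ opposite (lookup s e)
  flip-≡ e s = lookup∘updateAt e s

  flip-≢ : ∀ {e f} s → f ≢ e → lookup (flip e s) f ≡ lookup s f
  flip-≢ {e} {f} s f≢e = lookup∘updateAt′ f e f≢e s

  opposite-*₁ : ∀ x y z → opposite x Sign.* y Sign.* z ≡ opposite (x Sign.* y Sign.* z)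
  opposite-*₁ Sign.+ Sign.+ _ = refl
  opposite-*₁ Sign.+ Sign.- z = sym (Sign.opposite-involutive z)
  opposite-*₁ Sign.- Sign.+ z = sym (Sign.opposite-involutive z)
  opposite-*₁ Sign.- Sign.- z = refl

  opposite-*₂ : ∀ x y z → x Sign.* opposite y Sign.* z ≡ opposite (x Sign.* y Sign.* z)
  opposite-*₂ x y z rewrite Sign.*-comm x (opposite y) | Sign.*-comm x y = opposite-*₁ y x z

  opposite-*₃ : ∀ x y z → x Sign.* y Sign.* opposite z ≡ opposite (x Sign.* y Sign.* z)
  opposite-*₃ Sign.+ Sign.+ _ = refl
  opposite-*₃ Sign.+ Sign.- z = refl
  opposite-*₃ Sign.- Sign.+ z = refl
  opposite-*₃ Sign.- Sign.- z = refl

  -- If two edges of a triangle coincided, some edge would have equal endpoints, against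
  -- `source<target`. Distinctness ensures that a flip changes exactly one factor of the sign.
  a≢b : ∀ {a b c} → IsTriangle (a , b , c) → a ≢ b
  a≢b {a} (_ , ta≡sb , _) refl = Fin.<⇒≢ (source<target a) (sym ta≡sb)

  b≢c : ∀ {a b c} → IsTriangle (a , b , c) → b ≢ c
  b≢c {a} (sa≡sc , ta≡sb , _) refl = Fin.<⇒≢ (source<target a) (trans sa≡sc (sym ta≡sb))

  a≢c : ∀ {a b c} → IsTriangle (a , b , c) → a ≢ c
  a≢c {a} {b} (_ , ta≡sb , tb≡tc) refl = Fin.<⇒≢ (source<target b) (sym (trans tb≡tc ta≡sb))

  triangleSign-flip-∈ : ∀ s {e T} → IsTriangle T → e ∈ₑ T →
    triangleSign (flip e s) T ≡ opposite (triangleSign s T)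
  triangleSign-flip-∈ s {T = a , b , c} T-tri (inj₁ refl)
    rewrite flip-≡ a s | flip-≢ s (≢-sym (a≢b T-tri)) | flip-≢ s (≢-sym (a≢c T-tri)) =
    opposite-*₁ (lookup s a) _ _
  triangleSign-flip-∈ s {T = a , b , c} T-tri (inj₂ (inj₁ refl))
    rewrite flip-≡ b s | flip-≢ s (a≢b T-tri) | flip-≢ s (≢-sym (b≢c T-tri)) =
    opposite-*₂ (lookup s a) _ _
  triangleSign-flip-∈ s {T = a , b , c} T-tri (inj₂ (inj₂ refl))
    rewrite flip-≡ c s | flip-≢ s (a≢c T-tri) | flip-≢ s (b≢c T-tri) =
    opposite-*₃ (lookup s a) _ _

  triangleSign-flip-∉ : ∀ s {e T} → ¬ e ∈ₑ T → triangleSign (flip e s) T ≡ triangleSign s T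
  triangleSign-flip-∉ s {T = a , b , c} e∉T
    rewrite flip-≢ s (e∉T ∘ inj₁ ∘ sym)
          | flip-≢ s (e∉T ∘ inj₂ ∘ inj₁ ∘ sym)
          | flip-≢ s (e∉T ∘ inj₂ ∘ inj₂ ∘ sym) = refl

-- Cyclic order on `Fin n` and a pigeonhole argument for triples.

module Cyclic where

  open ≡ using (refl; sym; trans; cong)

  -- The cyclic predecessor: by `glued-prev`, the edge through which triangle `i` is entered is the
  -- one through which triangle `prev i` is left.
  prev : ∀ {n} → Fin n → Fin n
  prev {suc n} zero    = Fin.fromℕ n
  prev         (suc i) = inject₁ i

  prev-surjective : ∀ {n} (i : Fin n) → ∃[ j ] prev j ≡ i
  prev-surjective i with view i
  ... | ‵fromℕ     = zero , refl
  ... | ‵inject₁ j = suc j , refl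

  prev-≢ : ∀ {n} → 2 ℕ.≤ n → (i : Fin n) → prev i ≢ i
  prev-≢ {suc zero}    (ℕ.s≤s ())
  prev-≢ {suc (suc n)} _ zero    ()
  prev-≢ {suc (suc n)} _ (suc i) inject₁i≡1+i =
    ℕ.1+n≢n (trans (cong Fin.toℕ (sym inject₁i≡1+i)) (Fin.toℕ-inject₁ i))

  glued-prev : ∀ {A : Set} {n} (f : Fin (suc n) → A) → f zero ≡ f (Fin.fromℕ n) →
    ∀ i → f (inject₁ i) ≡ f (suc (prev i))
  glued-prev f f0≡fn zero    = f0≡fn
  glued-prev f f0≡fn (suc i) = refl

  among₂ : ∀ {A : Set} {x y b c e : A} → x ≢ y →
    x ≡ b ⊎ x ≡ c → y ≡ b ⊎ y ≡ c → e ≡ b ⊎ e ≡ c → e ≡ x ⊎ e ≡ y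
  among₂ x≢y (inj₁ refl) (inj₁ refl) _ = contradiction refl x≢y
  among₂ x≢y (inj₁ refl) (inj₂ refl) e = e
  among₂ x≢y (inj₂ refl) (inj₁ refl) e = ⊎.swap e
  among₂ x≢y (inj₂ refl) (inj₂ refl) _ = contradiction refl x≢y

  -- Pigeonhole: distinct `x`, `y`, `z` use up all three places. `remove` strikes out the place of
  -- `x`, and `among₂` settles the other two.
  among₃ : ∀ {A : Set} {x y z a b c e : A} → x ≢ y → x ≢ z → y ≢ z →
    x ≡ a ⊎ x ≡ b ⊎ x ≡ c → y ≡ a ⊎ y ≡ b ⊎ y ≡ c → z ≡ a ⊎ z ≡ b ⊎ z ≡ c →
    e ≡ a ⊎ e ≡ b ⊎ e ≡ c → e ≡ x ⊎ e ≡ y ⊎ e ≡ z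
  among₃ {A} {x} {y} {z} {a} {b} {c} {e} x≢y x≢z y≢z x∈ y∈ z∈ e∈ =
    let _ , _ , others = remove x∈ in go (others y∈) (others z∈) (others e∈)
    where
    remove : x ≡ a ⊎ x ≡ b ⊎ x ≡ c → ∃[ u ] ∃[ v ] ∀ {w} → w ≡ a ⊎ w ≡ b ⊎ w ≡ c → w ≡ x ⊎ w ≡ u ⊎ w ≡ v
    remove (inj₁ refl)        = b , c , λ w∈ → w∈
    remove (inj₂ (inj₁ refl)) = a , c , [ inj₂ ∘ inj₁ , [ inj₁ , inj₂ ∘ inj₂ ]′ ]′
    remove (inj₂ (inj₂ refl)) = a , b , [ inj₂ ∘ inj₁ , [ inj₂ ∘ inj₂ , inj₁ ]′ ]′
    go : ∀ {u v} → y ≡ x ⊎ y ≡ u ⊎ y ≡ v → z ≡ x ⊎ z ≡ u ⊎ z ≡ v → e ≡ x ⊎ e ≡ u ⊎ e ≡ v →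
      e ≡ x ⊎ e ≡ y ⊎ e ≡ z
    go (inj₁ y≡x) _          _          = contradiction (sym y≡x) x≢y
    go (inj₂ y∈′) (inj₁ z≡x) _          = contradiction (sym z≡x) x≢z
    go (inj₂ y∈′) (inj₂ z∈′) (inj₁ e≡x) = inj₁ e≡x
    go (inj₂ y∈′) (inj₂ z∈′) (inj₂ e∈′) = inj₂ (among₂ y≢z y∈′ z∈′ e∈′)

-- Incidence of edges and triangles in a triadic cycle.

module TriadicCycle {n : ℕ} {G : Graph} (tc : IsTriadicCycle n G) where

  open ≡ using (refl; sym; trans; cong; subst)
  open Graph G
  open IsTriadicCycle tc
  open Cyclic

  shared-prev : ∀ i → shared (inject₁ i) ≡ shared (suc (prev i))
  shared-prev = glued-prev shared glued

  prev≢ : ∀ i → prev i ≢ i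
  prev≢ = prev-≢ (ℕ.<⇒≤ n≥3)

  -- Injectivity is given for entry edges; an exit edge is the entry edge of the next triangle,
  -- which `prev-surjective` finds.
  shared-suc-injective : Injective _≡_ _≡_ (shared ∘ suc)
  shared-suc-injective {i} {j} eq
    with k , refl ← prev-surjective i | l , refl ← prev-surjective j =
    cong prev (shared-injective (trans (shared-prev k) (trans eq (sym (shared-prev l)))))

  shared-≢ : ∀ i → shared (inject₁ i) ≢ shared (suc i)
  shared-≢ i eq = prev≢ i (shared-suc-injective (trans (sym (shared-prev i)) eq))

  private≢shared-in : ∀ i → private-edge i ≢ shared (inject₁ i)
  private≢shared-in i eq = prev≢ i (sym (private-edge-only i (prev i)
    (subst (_∈ₑ triangle (prev i)) (sym (trans eq (shared-prev i))) (shared-out (prev i)))))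

  private≢shared-out : ∀ i → private-edge i ≢ shared (suc i)
  private≢shared-out i eq with j , refl ← prev-surjective i =
    prev≢ j (private-edge-only (prev j) j
      (subst (_∈ₑ triangle j) (sym (trans eq (sym (shared-prev j)))) (shared-in j)))

  -- The private, entry and exit edges are pairwise distinct, so they exhaust the triangle.
  ∈-triangle : ∀ {e} i → e ∈ₑ triangle i → e ≡ private-edge i ⊎ e ≡ shared (inject₁ i) ⊎ e ≡ shared (suc i)
  ∈-triangle i = among₃ (private≢shared-in i) (private≢shared-out i) (shared-≢ i)
    (private-edge-in i) (shared-in i) (shared-out i)

  -- The witness is the neighbour across the edge: `prev j` for the entry edge, the `k` with
  -- `prev k ≡ j` for the exit edge. A private edge has no second triangle and gets the default `j`.
  other-triangle : ∀ {e} j → e ∈ₑ triangle j → ∃[ k ] ∀ i → e ∈ₑ triangle i → i ≡ j ⊎ i ≡ k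
  other-triangle j e∈j with ∈-triangle j e∈j
  ... | inj₁ refl = j , λ i e∈i → inj₁ (sym (private-edge-only j i e∈i))
  ... | inj₂ (inj₁ refl) = prev j , λ i e∈i → case-in i e∈i (∈-triangle i e∈i)
    where
    case-in : ∀ i → shared (inject₁ j) ∈ₑ triangle i → _ → i ≡ j ⊎ i ≡ prev j
    case-in i e∈i (inj₁ e≡priv) = inj₁ (private-edge-only i j (subst (_∈ₑ triangle j) e≡priv e∈j))
    case-in i e∈i (inj₂ (inj₁ eq)) = inj₁ (shared-injective (sym eq))
    case-in i e∈i (inj₂ (inj₂ eq)) = inj₂ (shared-suc-injective (trans (sym eq) (shared-prev j)))
  ... | inj₂ (inj₂ refl) with k , refl ← prev-surjective j = k , λ i e∈i → case-out i e∈i (∈-triangle i e∈i)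
    where
    case-out : ∀ i → shared (suc (prev k)) ∈ₑ triangle i → _ → i ≡ prev k ⊎ i ≡ k
    case-out i e∈i (inj₁ e≡priv) = inj₁ (private-edge-only i (prev k) (subst (_∈ₑ triangle (prev k)) e≡priv e∈j))
    case-out i e∈i (inj₂ (inj₁ eq)) = inj₂ (shared-injective (trans (sym eq) (sym (shared-prev k))))
    case-out i e∈i (inj₂ (inj₂ eq)) = inj₁ (shared-suc-injective (sym eq))

  -- An edge is determined by a triangle covering it and its position there. The exact number is
  -- `2 n`; the cruder bound costs only a constant.
  #edges≤n*3 : #edges ℕ.≤ n ℕ.* 3
  #edges≤n*3 = Fin.injective⇒≤ {f = λ e → combine (proj₁ (edge-covered e)) (position (proj₂ (edge-covered e)))}
    λ {e} {f} eq →
      let i≡j , same = Fin.combine-injective _ (position (proj₂ (edge-covered e))) _ _ eq in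
      position-injective (cong triangle i≡j) (proj₂ (edge-covered e)) (proj₂ (edge-covered f)) same
    where
    position : ∀ {e T} → e ∈ₑ T → Fin 3
    position (inj₁ _)        = 0F
    position (inj₂ (inj₁ _)) = 1F
    position (inj₂ (inj₂ _)) = 2F
    position-injective : ∀ {e f T U} → T ≡ U → (e∈T : e ∈ₑ T) (f∈U : f ∈ₑ U) → position e∈T ≡ position f∈U → e ≡ f
    position-injective refl (inj₁ refl)        (inj₁ refl)        _ = refl
    position-injective refl (inj₁ _)           (inj₂ (inj₁ _))    ()
    position-injective refl (inj₁ _)           (inj₂ (inj₂ _))    ()
    position-injective refl (inj₂ (inj₁ refl)) (inj₂ (inj₁ refl)) _ = refl
    position-injective refl (inj₂ (inj₂ refl)) (inj₂ (inj₂ refl)) _ = refl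

-- Counting imbalanced triangles and negative edges under a flip.

module Counts {c ℓ₁ ℓ₂} (ℝ : RealNumbers c ℓ₁ ℓ₂) (p : RealNumbers.Carrier ℝ)
  {n : ℕ} {G : Graph} (tc : IsTriadicCycle n G) where

  open Graph G
  open IsTriadicCycle tc
  open TriadicCycle tc
  open TriadDynamics ℝ p G using (Labeling; flip)
  open TriangleSigns ℝ p G
  open FiniteSums
  open Sum ℕ.+-0-commutativeMonoid using (sum)
  open ℕ.≤-Reasoning

  imbalance : Labeling → Fin n → ℕ
  imbalance s i = weight (triangleSign s (triangle i))

  -- Counting over the indices in `Fin n`, rather than along `imbalancedTriangles`, allows a flip to
  -- be analysed triangle by triangle.
  #imbalanced #negative : Labeling → ℕ
  #imbalanced s = sum (imbalance s)
  #negative s   = sum (weight ∘ lookup s)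

  #imbalanced≤n : ∀ s → #imbalanced s ℕ.≤ n
  #imbalanced≤n s = begin
    #imbalanced s      ≤⟨ sum-≤ (λ i → weight≤1 (triangleSign s (triangle i))) ⟩
    sum {n} (const 1)  ≡⟨ ≡.trans (sum-const n 1) (ℕ.*-identityʳ n) ⟩
    n                  ∎

  #negative≤n*3 : ∀ s → #negative s ℕ.≤ n ℕ.* 3
  #negative≤n*3 s = begin
    #negative s              ≤⟨ sum-≤ (λ e → weight≤1 (lookup s e)) ⟩
    sum {#edges} (const 1)   ≡⟨ ≡.trans (sum-const #edges 1) (ℕ.*-identityʳ #edges) ⟩
    #edges                   ≤⟨ #edges≤n*3 ⟩
    n ℕ.* 3                  ∎

  #negative-flip-- : ∀ s e → lookup s e ≡ Sign.- → #negative (flip e s) ℕ.+ 1 ℕ.≤ #negative s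
  #negative-flip-- s e se≡- = sum-+δ-≤ {f = weight ∘ lookup (flip e s)} e pointwise
    where
    pointwise : ∀ f → weight (lookup (flip e s) f) ℕ.+ δ e f ℕ.≤ weight (lookup s f)
    pointwise f with f Fin.≟ e
    ... | yes ≡.refl rewrite flip-≡ e s | se≡- = ℕ.≤-refl
    ... | no f≢e rewrite flip-≢ s f≢e = ℕ.≤-reflexive (ℕ.+-identityʳ _)

  #negative-flip : ∀ s e → #negative (flip e s) ℕ.≤ #negative s ℕ.+ 1
  #negative-flip s e = ℕ.≤-trans (sum-≤ pointwise) (ℕ.≤-reflexive (sum-+δ (weight ∘ lookup s) e))
    where
    pointwise : ∀ f → weight (lookup (flip e s) f) ℕ.≤ weight (lookup s f) ℕ.+ δ e f
    pointwise f with f Fin.≟ e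
    ... | yes ≡.refl = ℕ.≤-trans (weight≤1 (lookup (flip e s) e)) (ℕ.m≤n+m 1 _)
    ... | no f≢e rewrite flip-≢ s f≢e = ℕ.m≤m+n _ 0

  -- Triangle `j` becomes balanced, which frees the unit `δ j i`; a triangle avoiding `e` keeps its
  -- sign. Uniqueness is asked at the single index `i`, so that the estimate also applies to shared
  -- edges away from the neighbour.
  imbalance-flip : ∀ s {e j} i → triangleSign s (triangle j) ≡ Sign.- → e ∈ₑ triangle j →
    (e ∈ₑ triangle i → i ≡ j) → imbalance (flip e s) i ℕ.+ δ j i ℕ.≤ imbalance s i
  imbalance-flip s {e} {j} i sign≡- e∈j unique with i Fin.≟ j
  ... | yes ≡.refl rewrite triangleSign-flip-∈ s (triangle-valid j) e∈j | sign≡- = ℕ.≤-refl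
  ... | no i≢j rewrite triangleSign-flip-∉ s {e} {triangle i} (i≢j ∘ unique) = ℕ.≤-reflexive (ℕ.+-identityʳ _)

  -- The flip balances triangle `j` and can spoil at most its neighbour `k`, so `δ j` on the left
  -- and `δ k` on the right add one each and cancel. The default `k = j` satisfies the same
  -- inequality.
  #imbalanced-flip : ∀ s {e} j → triangleSign s (triangle j) ≡ Sign.- → e ∈ₑ triangle j →
    #imbalanced (flip e s) ℕ.≤ #imbalanced s
  #imbalanced-flip s {e} j sign≡- e∈j with k , only ← other-triangle j e∈j = ℕ.+-cancelʳ-≤ 1 _ _ (begin
    #imbalanced (flip e s) ℕ.+ 1             ≤⟨ sum-+δ-≤ {f = imbalance (flip e s)} j pointwise ⟩
    sum (λ i → imbalance s i ℕ.+ δ k i)      ≡⟨ sum-+δ (imbalance s) k ⟩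
    #imbalanced s ℕ.+ 1                      ∎)
    where
    pointwise : ∀ i → imbalance (flip e s) i ℕ.+ δ j i ℕ.≤ imbalance s i ℕ.+ δ k i
    pointwise i with i Fin.≟ k
    ... | no i≢k = ℕ.≤-trans
      (imbalance-flip s i sign≡- e∈j λ e∈i → [ (λ i≡j → i≡j) , (λ i≡k → contradiction i≡k i≢k) ]′ (only i e∈i))
      (ℕ.m≤m+n _ 0)
    ... | yes ≡.refl with i Fin.≟ j
    ... | no _ rewrite ℕ.+-identityʳ (imbalance (flip e s) i) =
      ℕ.≤-trans (weight≤1 (triangleSign (flip e s) (triangle i))) (ℕ.m≤n+m 1 _)
    ... | yes ≡.refl rewrite triangleSign-flip-∈ s (triangle-valid j) e∈j | sign≡- = ℕ.s≤s ℕ.z≤n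

  #imbalanced-flip-private : ∀ s j → triangleSign s (triangle j) ≡ Sign.- →
    #imbalanced (flip (private-edge j) s) ℕ.+ 1 ℕ.≤ #imbalanced s
  #imbalanced-flip-private s j sign≡- = sum-+δ-≤ {f = imbalance (flip (private-edge j) s)} j λ i →
    imbalance-flip s i sign≡- (private-edge-in j) (≡.sym ∘ private-edge-only j i)

-- Drift of the potential and the final bound.

module Potential {c ℓ₁ ℓ₂} (ℝ : RealNumbers c ℓ₁ ℓ₂) {p : RealNumbers.Carrier ℝ}
  (p>0 : RealNumbers._<_ ℝ (RealNumbers.0# ℝ) p) (p<1 : RealNumbers._<_ ℝ p (RealNumbers.1# ℝ))
  {n : ℕ} {G : Graph} (tc : IsTriadicCycle n G) where

  open RealNumbers ℝ
  open RealProperties ℝ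
  open Graph G
  open IsTriadicCycle tc
  open TriadDynamics ℝ p G
  open TriangleSigns ℝ p G
  open Counts ℝ p tc
  open Expectation ℝ p G
  open ExpectedHittingTime ℝ (<-asym p>0) (<-asym p<1) G
  open ≤-Reasoning

  q r α p̅ : Carrier
  q = p ⊓ ½
  r = recip q (⊓-½-positive p>0 p<1)
  α = r + r
  p̅ = 1# - p

  Φ : Labeling → Carrier
  Φ s = α * fromℕ (#imbalanced s) + fromℕ (#negative s)

  q≤p : q ≤ p
  q≤p = proj₁ (⊓-infimum p ½)

  q≤½ : q ≤ ½
  q≤½ = proj₁ (proj₂ (⊓-infimum p ½))

  qr≈1 : q * r ≈ 1#
  qr≈1 = *-recip q _

  p-nonNegative : 0# ≤ p
  p-nonNegative = <-asym p>0

  p̅-nonNegative : 0# ≤ p̅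
  p̅-nonNegative = 1-x-nonNegative (<-asym p<1)

  r-nonNegative : 0# ≤ r
  r-nonNegative = <-asym (recip-positive q _)

  α-nonNegative : 0# ≤ α
  α-nonNegative = +-nonNegative r-nonNegative r-nonNegative

  -- The largest possible excess of `Ψ` after a flip over `Φ` before it: one for the elapsed step
  -- and one for a new negative edge.
  two : Carrier
  two = 1# + 1#

  two≤r : two ≤ r
  two≤r = begin
    1# + 1#            ≈⟨ +-cong qr≈1 qr≈1 ⟨
    q * r + q * r      ≈⟨ distribʳ r q q ⟨
    (q + q) * r        ≤⟨ *-monoʳ-≤ r-nonNegative (+-mono-≤ q≤½ q≤½) ⟩
    (½ + ½) * r        ≈⟨ trans (*-congʳ ½+½≈1) (*-identityˡ r) ⟩
    r                  ∎

  -- For the case where the private edge is the negative one: `q ≤ p` makes the mean gain `p * α` at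
  -- least 2.
  two*p̅≤p*α : two * p̅ ≤ p * α
  two*p̅≤p*α = begin
    two * p̅            ≤⟨ *-monoˡ-≤ (+-nonNegative 0≤1 0≤1) (≤-trans (x≤y+x p-nonNegative) (≤-reflexive (x+[1-x]≈1 p))) ⟩
    two * 1#           ≈⟨ *-identityʳ two ⟩
    1# + 1#            ≈⟨ +-cong qr≈1 qr≈1 ⟨
    q * r + q * r      ≈⟨ distribˡ q r r ⟨
    q * α              ≤⟨ *-monoʳ-≤ α-nonNegative q≤p ⟩
    p * α              ∎

  -- For the case where the private edge is positive: half of `α` is `r`, and `q ≤ ½` makes `r` at
  -- least 2.
  two*p̅≤p̅*½*α : two * p̅ ≤ p̅ * (½ * α)
  two*p̅≤p̅*½*α = begin
    two * p̅               ≤⟨ *-monoʳ-≤ p̅-nonNegative two≤r ⟩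
    r * p̅                 ≈⟨ *-congʳ (trans (*-congʳ ½+½≈1) (*-identityˡ r)) ⟨
    (½ + ½) * r * p̅       ≈⟨ solve 3 (λ h r p → (h :+ h) :* r :* p := p :* (h :* (r :+ r))) refl ½ r p̅ ⟩
    p̅ * (½ * α)           ∎

  -- The mean over one choice in a triangle with a single negative edge: `x` is the value after
  -- flipping that edge, `y` and `z` the values after flipping the other two.
  average : Carrier → Carrier → Carrier → Carrier
  average x y z = p * x + p̅ * (½ * y + ½ * z)

  average-mono : ∀ {x x′ y y′ z z′} → x ≤ x′ → y ≤ y′ → z ≤ z′ → average x y z ≤ average x′ y′ z′
  average-mono x≤x′ y≤y′ z≤z′ = +-mono-≤ (*-monoˡ-≤ p-nonNegative x≤x′)
    (*-monoˡ-≤ p̅-nonNegative (+-mono-≤ (*-monoˡ-≤ (<-asym ½-positive) y≤y′) (*-monoˡ-≤ (<-asym ½-positive) z≤z′)))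

  average-base : ∀ φ → average φ (φ + two) (φ + two) ≈ φ + two * p̅
  average-base φ = begin-equality
    p * φ + p̅ * (½ * (φ + two) + ½ * (φ + two))
      ≈⟨ solve 4 (λ p p̅ h φ → p :* φ :+ p̅ :* (h :* (φ :+ con 2) :+ h :* (φ :+ con 2)) := p :* φ :+ p̅ :* ((h :+ h) :* (φ :+ con 2))) refl p p̅ ½ φ ⟩
    p * φ + p̅ * ((½ + ½) * (φ + two))
      ≈⟨ +-congˡ (*-congˡ (trans (*-congʳ ½+½≈1) (*-identityˡ _))) ⟩
    p * φ + p̅ * (φ + two)
      ≈⟨ solve 3 (λ p p̅ φ → p :* φ :+ p̅ :* (φ :+ con 2) := (p :+ p̅) :* φ :+ con 2 :* p̅) refl p p̅ φ ⟩
    (p + p̅) * φ + two * p̅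
      ≈⟨ +-congʳ (trans (*-congʳ (x+[1-x]≈1 p)) (*-identityˡ φ)) ⟩
    φ + two * p̅ ∎

  -- The worst case without any gain exceeds `φ` by `two * p̅`, as `average-base` computes, so a
  -- mean gain of that size absorbs the excess.
  average≤ : ∀ {φ x y z gain} → two * p̅ ≤ gain →
    average x y z + gain ≤ average φ (φ + two) (φ + two) → average x y z ≤ φ
  average≤ {φ} {x} {y} {z} {gain} 2p̅≤gain le = +-cancelʳ-≤ gain (begin
    average x y z + gain               ≤⟨ le ⟩
    average φ (φ + two) (φ + two)      ≈⟨ average-base φ ⟩
    φ + two * p̅                        ≤⟨ +-monoʳ-≤ φ 2p̅≤gain ⟩
    φ + gain                           ∎)

  average≤₁ : ∀ {φ x y z} → x + α ≤ φ → y ≤ φ + two → z ≤ φ + two → average x y z ≤ φ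
  average≤₁ {φ} {x} {y} {z} hx hy hz = average≤ two*p̅≤p*α (begin
    average x y z + p * α
      ≈⟨ solve 4 (λ p x a w → p :* x :+ w :+ p :* a := p :* (x :+ a) :+ w) refl p x α (p̅ * (½ * y + ½ * z)) ⟩
    average (x + α) y z
      ≤⟨ average-mono hx hy hz ⟩
    average φ (φ + two) (φ + two) ∎)

  average≤₂ : ∀ {φ x y z} → x ≤ φ → y + α ≤ φ + two → z ≤ φ + two → average x y z ≤ φ
  average≤₂ {φ} {x} {y} {z} hx hy hz = average≤ two*p̅≤p̅*½*α (begin
    average x y z + p̅ * (½ * α)
      ≈⟨ solve 6 (λ w p̅ h y z a → w :+ p̅ :* (h :* y :+ h :* z) :+ p̅ :* (h :* a) := w :+ p̅ :* (h :* (y :+ a) :+ h :* z)) refl (p * x) p̅ ½ y z α ⟩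
    average x (y + α) z
      ≤⟨ average-mono hx hy hz ⟩
    average φ (φ + two) (φ + two) ∎)

  average-comm : ∀ x y z → average x y z ≈ average x z y
  average-comm x y z = +-congˡ (*-congˡ (+-comm _ _))

  Ψ : Labeling → Carrier
  Ψ s = 1# + Φ s

  Φ-nonNegative : ∀ s → 0# ≤ Φ s
  Φ-nonNegative s = +-nonNegative (*-nonNegative α-nonNegative (fromℕ-nonNegative (#imbalanced s)))
    (fromℕ-nonNegative (#negative s))

  fromℕ-+1 : ∀ m → fromℕ (m ℕ.+ 1) ≈ fromℕ m + 1#
  fromℕ-+1 m = trans (fromℕ-+ m 1) (+-congˡ (+-identityʳ 1#))

  module _ {s s′ : Labeling} where

    private
      X X′ N N′ : Carrier
      X  = fromℕ (#imbalanced s)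
      X′ = fromℕ (#imbalanced s′)
      N  = fromℕ (#negative s)
      N′ = fromℕ (#negative s′)

    Ψ≤Φ : X′ ≤ X → N′ + 1# ≤ N → Ψ s′ ≤ Φ s
    Ψ≤Φ X′≤X N′+1≤N = begin
      1# + (α * X′ + N′)  ≈⟨ solve 2 (λ x n → con 1 :+ (x :+ n) := x :+ (n :+ con 1)) refl (α * X′) N′ ⟩
      α * X′ + (N′ + 1#)  ≤⟨ +-mono-≤ (*-monoˡ-≤ α-nonNegative X′≤X) N′+1≤N ⟩
      α * X + N           ∎

    Ψ≤Φ+two : X′ ≤ X → N′ ≤ N + 1# → Ψ s′ ≤ Φ s + two
    Ψ≤Φ+two X′≤X N′≤N+1 = begin
      1# + (α * X′ + N′)        ≤⟨ +-monoʳ-≤ 1# (+-mono-≤ (*-monoˡ-≤ α-nonNegative X′≤X) N′≤N+1) ⟩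
      1# + (α * X + (N + 1#))   ≈⟨ solve 2 (λ x n → con 1 :+ (x :+ (n :+ con 1)) := x :+ n :+ con 2) refl (α * X) N ⟩
      α * X + N + two           ∎

    Ψ+α≤Φ : X′ + 1# ≤ X → N′ + 1# ≤ N → Ψ s′ + α ≤ Φ s
    Ψ+α≤Φ X′+1≤X N′+1≤N = begin
      1# + (α * X′ + N′) + α       ≈⟨ solve 3 (λ a x n → con 1 :+ (a :* x :+ n) :+ a := a :* (x :+ con 1) :+ (n :+ con 1)) refl α X′ N′ ⟩
      α * (X′ + 1#) + (N′ + 1#)    ≤⟨ +-mono-≤ (*-monoˡ-≤ α-nonNegative X′+1≤X) N′+1≤N ⟩
      α * X + N                    ∎

    Ψ+α≤Φ+two : X′ + 1# ≤ X → N′ ≤ N + 1# → Ψ s′ + α ≤ Φ s + two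
    Ψ+α≤Φ+two X′+1≤X N′≤N+1 = begin
      1# + (α * X′ + N′) + α            ≈⟨ solve 3 (λ a x n → con 1 :+ (a :* x :+ n) :+ a := con 1 :+ (a :* (x :+ con 1) :+ n)) refl α X′ N′ ⟩
      1# + (α * (X′ + 1#) + N′)         ≤⟨ +-monoʳ-≤ 1# (+-mono-≤ (*-monoˡ-≤ α-nonNegative X′+1≤X) N′≤N+1) ⟩
      1# + (α * X + (N + 1#))           ≈⟨ solve 2 (λ x n → con 1 :+ (x :+ (n :+ con 1)) := x :+ n :+ con 2) refl (α * X) N ⟩
      α * X + N + two                   ∎

  fromℕ-+1-≤ : ∀ {l m} → l ℕ.+ 1 ℕ.≤ m → fromℕ l + 1# ≤ fromℕ m
  fromℕ-+1-≤ {l} l+1≤m = ≤-trans (≤-reflexive (sym (fromℕ-+1 l))) (fromℕ-mono-≤ l+1≤m)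

  fromℕ-≤-+1 : ∀ {l m} → l ℕ.≤ m ℕ.+ 1 → fromℕ l ≤ fromℕ m + 1#
  fromℕ-≤-+1 {m = m} l≤m+1 = ≤-trans (fromℕ-mono-≤ l≤m+1) (≤-reflexive (fromℕ-+1 m))

  module _ (s : Labeling) {j : Fin n} (imbalanced : triangleSign s (triangle j) ≡ Sign.-) where

    Ψ-flip-- : ∀ {e} → e ∈ₑ triangle j → lookup s e ≡ Sign.- → Ψ (flip e s) ≤ Φ s
    Ψ-flip-- {e} e∈j e- = Ψ≤Φ {s} {flip e s} (fromℕ-mono-≤ (#imbalanced-flip s j imbalanced e∈j))
      (fromℕ-+1-≤ (#negative-flip-- s e e-))

    Ψ-flip : ∀ {e} → e ∈ₑ triangle j → Ψ (flip e s) ≤ Φ s + two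
    Ψ-flip {e} e∈j = Ψ≤Φ+two {s} {flip e s} (fromℕ-mono-≤ (#imbalanced-flip s j imbalanced e∈j))
      (fromℕ-≤-+1 (#negative-flip s e))

    Ψ-flip-private-- : ∀ {e} → private-edge j ≡ e → lookup s e ≡ Sign.- → Ψ (flip e s) + α ≤ Φ s
    Ψ-flip-private-- {e} ≡.refl e- = Ψ+α≤Φ {s} {flip e s} (fromℕ-+1-≤ (#imbalanced-flip-private s j imbalanced))
      (fromℕ-+1-≤ (#negative-flip-- s e e-))

    Ψ-flip-private : ∀ {e} → private-edge j ≡ e → Ψ (flip e s) + α ≤ Φ s + two
    Ψ-flip-private {e} ≡.refl = Ψ+α≤Φ+two {s} {flip e s} (fromℕ-+1-≤ (#imbalanced-flip-private s j imbalanced))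
      (fromℕ-≤-+1 (#negative-flip s e))

    Ψ-after : Edge → Carrier
    Ψ-after e = Ψ (flip e s)

    -- Which edge is private decides where `α` is gained: at the negative edge with probability `p`,
    -- or at one of the others with probability `p̅ * ½`.
    oneNegative-drift : ∀ {x y z} → lookup s x ≡ Sign.- →
      x ∈ₑ triangle j → y ∈ₑ triangle j → z ∈ₑ triangle j → private-edge j ∈ₑ (x , y , z) →
      𝔼 (bernoulli p (pure x) (uniform (y ∷ z ∷ []))) Ψ-after ≤ Φ s
    oneNegative-drift {x} {y} {z} x- x∈j y∈j z∈j priv = begin
      𝔼 (bernoulli p (pure x) (uniform (y ∷ z ∷ []))) Ψ-after
        ≈⟨ 𝔼-bernoulli p (pure x) (uniform (y ∷ z ∷ [])) Ψ-after ⟩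
      p * 𝔼 (pure x) Ψ-after + p̅ * (½ * Ψ-after y + (½ * Ψ-after z + 0#))
        ≈⟨ +-cong (*-congˡ (𝔼-pure x Ψ-after)) (*-congˡ (+-congˡ (+-identityʳ _))) ⟩
      average (Ψ-after x) (Ψ-after y) (Ψ-after z)
        ≤⟨ by-private-edge priv ⟩
      Φ s ∎
      where
      by-private-edge : private-edge j ∈ₑ (x , y , z) → average (Ψ-after x) (Ψ-after y) (Ψ-after z) ≤ Φ s
      by-private-edge (inj₁ priv≡x) =
        average≤₁ (Ψ-flip-private-- priv≡x x-) (Ψ-flip y∈j) (Ψ-flip z∈j)
      by-private-edge (inj₂ (inj₁ priv≡y)) =
        average≤₂ (Ψ-flip-- x∈j x-) (Ψ-flip-private priv≡y) (Ψ-flip z∈j)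
      by-private-edge (inj₂ (inj₂ priv≡z)) = ≤-trans (≤-reflexive (average-comm _ _ _))
        (average≤₂ (Ψ-flip-- x∈j x-) (Ψ-flip-private priv≡z) (Ψ-flip y∈j))

  -- The labels are variables tied to `s` by equations, so that matching on them lets `chooseEdge`
  -- compute while the facts about `lookup` survive.
  chooseEdge-drift : ∀ s j {a b c} x y z → lookup s a ≡ x → lookup s b ≡ y → lookup s c ≡ z →
    triangle j ≡ (a , b , c) → x Sign.* y Sign.* z ≢ Sign.+ →
    𝔼 (chooseEdge (x , y , z) (a , b , c)) (λ e → Ψ (flip e s)) ≤ Φ s
  chooseEdge-drift s j {a} {b} {c} x y z a≡x b≡y c≡z j≡abc xyz≢+ = go x y z a≡x b≡y c≡z xyz≢+
    where
    a∈j : a ∈ₑ triangle j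
    a∈j = ≡.subst (a ∈ₑ_) (≡.sym j≡abc) (inj₁ ≡.refl)
    b∈j : b ∈ₑ triangle j
    b∈j = ≡.subst (b ∈ₑ_) (≡.sym j≡abc) (inj₂ (inj₁ ≡.refl))
    c∈j : c ∈ₑ triangle j
    c∈j = ≡.subst (c ∈ₑ_) (≡.sym j≡abc) (inj₂ (inj₂ ≡.refl))
    private∈ : private-edge j ∈ₑ (a , b , c)
    private∈ = ≡.subst (private-edge j ∈ₑ_) j≡abc (private-edge-in j)

    ≢+⇒≡- : ∀ σ → σ ≢ Sign.+ → σ ≡ Sign.-
    ≢+⇒≡- Sign.+ ≢+ = contradiction ≡.refl ≢+
    ≢+⇒≡- Sign.- _  = ≡.refl

    imbalanced : triangleSign s (triangle j) ≡ Sign.-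
    imbalanced = ≡.trans (≡.cong (triangleSign s) j≡abc)
      (≡.trans (≡.cong₂ Sign._*_ (≡.cong₂ Sign._*_ a≡x b≡y) c≡z) (≢+⇒≡- _ xyz≢+))

    go : ∀ x y z → lookup s a ≡ x → lookup s b ≡ y → lookup s c ≡ z → x Sign.* y Sign.* z ≢ Sign.+ →
      𝔼 (chooseEdge (x , y , z) (a , b , c)) (λ e → Ψ (flip e s)) ≤ Φ s
    go Sign.- Sign.+ Sign.+ a- b+ c+ _ = oneNegative-drift s imbalanced a- a∈j b∈j c∈j private∈
    -- `oneNegative-drift` expects the negative edge first; the membership of the private edge is
    -- permuted to match.
    go Sign.+ Sign.- Sign.+ a+ b- c+ _ = oneNegative-drift s imbalanced b- b∈j a∈j c∈j
      ([ inj₂ ∘ inj₁ , [ inj₁ , inj₂ ∘ inj₂ ]′ ]′ private∈)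
    go Sign.+ Sign.+ Sign.- a+ b+ c- _ = oneNegative-drift s imbalanced c- c∈j a∈j b∈j
      ([ inj₂ ∘ inj₁ , [ inj₂ ∘ inj₂ , inj₁ ]′ ]′ private∈)
    go Sign.- Sign.- Sign.- a- b- c- _ = ≤-trans
      (𝔼-mono-All (uniform-isProbability (a ∷ b ∷ c ∷ [])) {g = const (Φ s)}
        (Ψ-flip-- s imbalanced a∈j a- ∷ Ψ-flip-- s imbalanced b∈j b- ∷ Ψ-flip-- s imbalanced c∈j c- ∷ []))
      (≤-reflexive (𝔼-const (uniform-isProbability (a ∷ b ∷ c ∷ [])) (Φ s)))
    go Sign.+ Sign.+ Sign.+ _ _ _ ≢+ = contradiction ≡.refl ≢+
    go Sign.+ Sign.- Sign.- _ _ _ ≢+ = contradiction ≡.refl ≢+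
    go Sign.- Sign.+ Sign.- _ _ _ ≢+ = contradiction ≡.refl ≢+
    go Sign.- Sign.- Sign.+ _ _ _ ≢+ = contradiction ≡.refl ≢+

  triangle-drift : ∀ s T → IsTriangle T → ¬ Balanced s T →
    𝔼 (chooseEdge (labels s T) T) (λ e → Ψ (flip e s)) ≤ Φ s
  triangle-drift s T T-tri T-imb with j , j≡T ← triangle-all T T-tri =
    chooseEdge-drift s j _ _ _ ≡.refl ≡.refl ≡.refl j≡T T-imb

  imbalancedTriangles-sound : ∀ s → All (λ T → IsTriangle T × ¬ Balanced s T) (imbalancedTriangles s)
  imbalancedTriangles-sound s = All.zip
    ( All.filter⁺ (λ T → ¬? (balanced? s T)) (All.all-filter isTriangle?
        (cartesianProduct (allFin #edges) (cartesianProduct (allFin #edges) (allFin #edges))))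
    , All.all-filter (λ T → ¬? (balanced? s T)) triangles)

  -- The estimate holds for each imbalanced triangle separately, so it survives the average over the
  -- uniform choice among them.
  drift : Drift Φ
  drift s {T} {Ts} eq = begin
    𝔼 (step s) Ψ
      ≡⟨ ≡.cong (λ L → 𝔼 (stepFrom s L) Ψ) eq ⟩
    𝔼 (stepFrom s (T ∷ Ts)) Ψ
      ≈⟨ 𝔼->>= (uniform (T ∷ Ts)) (λ T′ → chooseEdge (labels s T′) T′ >>= λ e → pure (flip e s)) Ψ ⟩
    𝔼 (uniform (T ∷ Ts)) (λ T′ → 𝔼 (chooseEdge (labels s T′) T′ >>= λ e → pure (flip e s)) Ψ)
      ≈⟨ 𝔼-cong (uniform (T ∷ Ts)) (λ T′ → trans (𝔼->>= (chooseEdge (labels s T′) T′) (λ e → pure (flip e s)) Ψ)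
           (𝔼-cong (chooseEdge (labels s T′) T′) (λ e → 𝔼-pure (flip e s) Ψ))) ⟩
    𝔼 (uniform (T ∷ Ts)) (λ T′ → 𝔼 (chooseEdge (labels s T′) T′) (λ e → Ψ (flip e s)))
      ≤⟨ 𝔼-mono-All (uniform-isProbability (T ∷ Ts)) {g = const (Φ s)}
           (All.map⁺ (All.map (λ {T′} (T′-tri , T′-imb) → triangle-drift s T′ T′-tri T′-imb) sound)) ⟩
    𝔼 (uniform (T ∷ Ts)) (const (Φ s))
      ≈⟨ 𝔼-const (uniform-isProbability (T ∷ Ts)) (Φ s) ⟩
    Φ s ∎
    where
    sound : All (λ T → IsTriangle T × ¬ Balanced s T) (T ∷ Ts)
    sound = ≡.subst (All _) eq (imbalancedTriangles-sound s)

  -- The 5 is 2 + 3: the imbalanced triangles contribute at most `α * n`, which is `2 * n * r`, and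
  -- the at most `3 n` negative edges are below `3 * n * r` because `r` is at least 1.
  Φ≤ : ∀ s → Φ s ≤ fromℕ 5 * (fromℕ n * r)
  Φ≤ s = begin
    α * fromℕ (#imbalanced s) + fromℕ (#negative s)
      ≤⟨ +-mono-≤ (*-monoˡ-≤ α-nonNegative (fromℕ-mono-≤ (#imbalanced≤n s))) (fromℕ-mono-≤ (#negative≤n*3 s)) ⟩
    α * fromℕ n + fromℕ (n ℕ.* 3)
      ≈⟨ +-congˡ (trans (fromℕ-* n 3) (sym (*-identityʳ _))) ⟩
    α * fromℕ n + fromℕ n * fromℕ 3 * 1#
      ≤⟨ +-monoʳ-≤ _ (*-monoˡ-≤ (*-nonNegative (fromℕ-nonNegative n) (fromℕ-nonNegative 3)) (≤-trans (x≤x+y 0≤1) two≤r)) ⟩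
    α * fromℕ n + fromℕ n * fromℕ 3 * r
      ≈⟨ solve 2 (λ r n → (r :+ r) :* n :+ n :* (con 1 :+ (con 1 :+ (con 1 :+ con 0))) :* r :=
           (con 1 :+ (con 1 :+ (con 1 :+ (con 1 :+ (con 1 :+ con 0))))) :* (n :* r)) refl r (fromℕ n) ⟩
    fromℕ 5 * (fromℕ n * r) ∎

  balanceTime : ∃[ τ ] IsBalanceTime τ × τ ≤ fromℕ 5 * (fromℕ n * r)
  balanceTime = balanceTime-bounded Φ Φ-nonNegative drift Φ≤

theorem3 : ∀ {c ℓ₁ ℓ₂} (ℝ : RealNumbers c ℓ₁ ℓ₂) →
    let open RealNumbers ℝ in
    ∃[ C ] ∀ (p : Carrier) (p>0 : 0# < p) (p<1 : p < 1#) (n : ℕ) (G : Graph) → IsTriadicCycle n G →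
    ∃[ τ ] TriadDynamics.IsBalanceTime ℝ p G τ
    × τ ≤ C * (fromℕ n * recip (p ⊓ ½) (⊓-½-positive p>0 p<1))
theorem3 ℝ = fromℕ 5 , λ p p>0 p<1 n G tc → Potential.balanceTime ℝ p>0 p<1 tc
  where open RealNumbers ℝ
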